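{- The $\mathcal I^{\mathrm{cb}}$-interpretation (canonical upon the bounding interpretation) is a sound type-informative base interpretation of $\mathrm{HA}^\omega$.
   Context: $\mathrm{HA}^\omega$: intuitionistic theory with finite types generated by $\sigma\to\tau$ from ground types $\mathbb N$, $\mathbb B$; constants: combinators $\Pi,\Sigma$, zero $0^{\mathbb N}$, successor $\mathsf S^{\mathbb N\to\mathbb N}$, recursors $\mathsf R_\sigma:\mathbb N\to\sigma\to(\mathbb N\to\sigma\to\sigma)\to\sigma$ (simultaneous recursion allowed), Booleans $0^{\mathbb B},1^{\mathbb B}$, conditionals $\mathrm{Cond}_\sigma:\mathbb B\to\sigma\to\sigma\to\sigma$; relation symbols: only logical equality $\equiv_\sigma$ at every type. Formulas use $\bot,\wedge,\to,\forall x^\sigma,\exists x^\sigma$; $A\vee B$ abbreviates $\exists i^{\mathbb B}((i\equiv0\to A)\wedge(i\equiv1\to B))$. Axioms: equality and combinator axioms ($\Pi xy\equiv x$, $\Sigma xyz\equiv xz(yz)$); $\mathsf S$ injective, $0\notin\mathrm{range}(\mathsf S)$; $\mathsf R0wf\equiv w$, $\mathsf R(\mathsf Sn)wf\equiv fn(\mathsf Rnwf)$; $\neg(0\equiv_{\mathbb B}1)$; $D(0)\wedge D(1)\to\forall i^{\mathbb B}D(i)$ for all formulas $D$; $\mathrm{Cond}(0,x,y)\equiv x$, $\mathrm{Cond}(1,x,y)\equiv y$; induction for all formulas. Target language: the language of $\mathrm{HA}^\omega$ with the extra type constructor $\sigma\mapsto\sigma^*$ (non-empty finite subsets) and constants for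 singleton, union, indexed union $\bigcup_{w\in t}qw$, membership, combinators and recursors for all these types, and $\mathrm m:\mathbb N^*\to\mathbb N$ (maximum). $\mathcal S^\omega_*$ is the structure with $\mathcal S_{\mathbb N}=\mathbb N$, $\mathcal S_{\mathbb B}=\{0,1\}$, $\mathcal S_{\rho\to\sigma}$ all functions from $\mathcal S_\rho$ to $\mathcal S_\sigma$, $\mathcal S_{\sigma^*}$ all non-empty finite subsets of $\mathcal S_\sigma$. The target theory $T$ is the set of sentences true in $\mathcal S^\omega_*$. Witnessing types are the types generated from $\mathbb N$ by $\to$ and $*$; witnessing terms are terms of such types. $\mathcal L^{\mathcal I}$ adds to the language of $\mathrm{HA}^\omega$ a unary predicate $\mathcal I_\sigma(x^\sigma)$ for each type. Boldface letters are (possibly empty) tuples; $\forall\boldsymbol b\in\boldsymbol B$ is componentwise. $\mathcal I^{\mathrm{cb}}$: $\langle\mathcal I_{\mathbb N}(x)\rangle^n$ is $x\le n$ ($n:\mathbb N$, no negative witnesses); $\mathcal I_{\mathbb B}(i)$ has no witnesses at all and $\langle\mathcal I_{\mathbb B}(i)\rangle$ is true; and at function types $$\langle\mathcal I_{\rho\to\sigma}(h)\rangle^{\boldsymbol f,\boldsymbol g}_{\boldsymbol a,\boldsymbol d}:\equiv\forall x^\rho(\forall\boldsymbol b\in\boldsymbol g\boldsymbol a\boldsymbol d\,\langle\mathcal I_\rho(x)\rangle^{\boldsymbol a}_{\boldsymbol b}\to\langle\mathcal I_\sigma(hx)\rangle^{\boldsymbol f\boldsymbol a}_{\boldsymbol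 d}).$$ $\mathcal U$-interpretation: $\langle x\equiv_\sigma y\rangle$ is $x=y$; $\langle\bot\rangle:\equiv\bot$; $\langle A\wedge B\rangle^{\boldsymbol a,\boldsymbol c}_{\boldsymbol b,\boldsymbol d}:\equiv\langle A\rangle^{\boldsymbol a}_{\boldsymbol b}\wedge\langle B\rangle^{\boldsymbol c}_{\boldsymbol d}$; $\langle A\to B\rangle^{\boldsymbol f,\boldsymbol g}_{\boldsymbol a,\boldsymbol d}:\equiv\forall\boldsymbol b\in\boldsymbol g\boldsymbol a\boldsymbol d\,\langle A\rangle^{\boldsymbol a}_{\boldsymbol b}\to\langle B\rangle^{\boldsymbol f\boldsymbol a}_{\boldsymbol d}$; $\langle\forall xA\rangle^{\boldsymbol a}_{\boldsymbol b}:\equiv\forall x\langle A\rangle^{\boldsymbol a}_{\boldsymbol b}$; $\langle\exists xA\rangle^{\boldsymbol a}_{\boldsymbol B}:\equiv\exists x\forall\boldsymbol b\in\boldsymbol B\langle A\rangle^{\boldsymbol a}_{\boldsymbol b}$. $A(\boldsymbol x)$ is $\mathcal U$-interpretable if there are closed witnessing terms $\boldsymbol t$ with $T\vdash\forall\boldsymbol b\langle A(\boldsymbol x)\rangle^{\boldsymbol t}_{\boldsymbol b}$. $A^{\mathcal I}$ replaces $\forall x^\sigma(\dots)$ by $\forall x^\sigma(\mathcal I_\sigma(x)\to\dots)$ and $\exists x^\sigma(\dots)$ by $\exists x^\sigma(\mathcal I_\sigma(x)\wedge\dots)$. $A(\boldsymbol x)$ is $\mathcal I$-interpretable if $\forall\boldsymbol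 x(\mathcal I(\boldsymbol x)\to A^{\mathcal I}(\boldsymbol x))$ is $\mathcal U$-interpretable. A base interpretation is a sound type-informative base interpretation of $\mathrm{HA}^\omega$ if all $\mathcal I_\sigma(c)$ ($c^\sigma$ a constant of $\mathrm{HA}^\omega$) and all $\forall x^\sigma\forall f^{\sigma\to\tau}(\mathcal I_\sigma(x)\wedge\mathcal I_{\sigma\to\tau}(f)\to\mathcal I_\tau(fx))$ are $\mathcal U$-interpretable, and all non-logical axioms of $\mathrm{HA}^\omega$ are $\mathcal I$-interpretable. -}

module Defs where

open import Data.Bool.Base using (Bool; true; false; if_then_else_)
open import Data.Empty using (⊥)
open import Data.List.Base using (List; []; _∷_; _++_; map; foldr)
open import Data.List.Extrema.Nat using (max; max-mono-⊆)
open import Data.List.Membership.Propositional using () renaming (_∈_ to _∈ˡ_)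
open import Data.List.Membership.Propositional.Properties using (∈-++⁺ˡ; ∈-++⁺ʳ)
import Data.List.Membership.Setoid as SetoidMembership
import Data.List.Membership.Setoid.Properties as Membershipₚ
open import Data.List.NonEmpty.Base using (List⁺; toList; _⁺++⁺_; concatMap)
  renaming ([_] to [_]⁺)
open import Data.List.Relation.Binary.Subset.Setoid using (_⊆_)
open import Data.List.Relation.Unary.All as All using (All; []; _∷_)
open import Data.List.Relation.Unary.All.Properties using (++⁺; ++⁻; map⁺; map⁻)
import Data.List.Relation.Unary.Any as Any
open import Data.List.Relation.Unary.Any using (Any; here; there)
import Data.List.Relation.Unary.Any.Properties as Anyₚ
open import Data.Nat.Base using (ℕ; zero; suc)
import Data.Nat.Properties as ℕₚ
open import Data.Product.Base using (∃; _×_; _,_; proj₁; proj₂; map₂)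
open import Data.Product.Relation.Binary.Pointwise.NonDependent using (_×ₛ_)
open import Data.Sum.Base using (inj₁; inj₂)
open import Data.Unit.Base using (⊤; tt)
open import Function.Base using (_∘_; id)
open import Function.Bundles using (Func; _⟨$⟩_)
open import Function.Relation.Binary.Setoid.Equality using (_⇨_)
open import Level using (0ℓ)
open import Relation.Binary.Bundles using (Setoid)
open import Relation.Binary.PropositionalEquality as ≡ using (_≡_; refl)

infixr 6 _⇒_ _⇒*_ _⇛_
infix  8 _✶

data Ty : Set where
  N B : Ty
  _⇒_ : Ty → Ty → Ty
  _✶  : Ty → Ty

-- The types of HA^ω.  Proofs are unique, so HAType σ doubles as the
-- datatype of these types, indexed by the embedding into Ty.

data HAType : Ty → Set where
  N   : HAType N
  B   : HAType B
  _⇒_ : ∀ {σ τ} → HAType σ → HAType τ → HAType (σ ⇒ τ)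

data Witnessing : Ty → Set where
  N   : Witnessing N
  _⇒_ : ∀ {σ τ} → Witnessing σ → Witnessing τ → Witnessing (σ ⇒ τ)
  _✶  : ∀ {σ} → Witnessing σ → Witnessing (σ ✶)

Ctx : Set
Ctx = List Ty

variable
  ρ σ τ       : Ty
  Γ Δ ρs σs τs : List Ty

_⇒*_ : List Ty → Ty → Ty
σs ⇒* τ = foldr _⇒_ τ σs

_⇛_ : List Ty → List Ty → List Ty
σs ⇛ τs = map (σs ⇒*_) τs

_✶* : List Ty → List Ty
σs ✶* = map _✶ σs

steps : List Ty → List Ty
steps σs = map (λ τ → N ⇒ σs ⇒* τ) σs

-- The constants of HA^ω, over an arbitrary class P of types.  R is
-- simultaneous recursion: R ps i returns the component i of the tuple
-- of type σs defined by recursion.  For a one-element σs its type is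
-- N ⇒ σ ⇒ (N ⇒ σ ⇒ σ) ⇒ σ.

data Con (P : Ty → Set) : Ty → Set where
  Π    : P σ → P τ → Con P (σ ⇒ τ ⇒ σ)
  Σ    : P ρ → P σ → P τ → Con P ((ρ ⇒ σ ⇒ τ) ⇒ (ρ ⇒ σ) ⇒ ρ ⇒ τ)
  O    : Con P N
  S    : Con P (N ⇒ N)
  R    : All P σs → τ ∈ˡ σs → Con P (N ⇒ σs ⇒* (steps σs ⇒* τ))
  O₂   : Con P B
  I₂   : Con P B
  Cond : P σ → Con P (B ⇒ σ ⇒ σ ⇒ σ)

Any-type : Ty → Set
Any-type _ = ⊤

data Con✶ : Ty → Set where
  base      : Con Any-type σ → Con✶ σ
  singleton : Con✶ (σ ⇒ σ ✶)
  union     : Con✶ (σ ✶ ⇒ σ ✶ ⇒ σ ✶)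
  ⋃         : Con✶ (σ ✶ ⇒ (σ ⇒ τ ✶) ⇒ τ ✶)
  m         : Con✶ (N ✶ ⇒ N)

forgetᶜ : Con HAType σ → Con Any-type σ
forgetᶜ (Π _ _)   = Π tt tt
forgetᶜ (Σ _ _ _) = Σ tt tt tt
forgetᶜ O         = O
forgetᶜ S         = S
forgetᶜ (R hs i)  = R (All.map (λ _ → tt) hs) i
forgetᶜ O₂        = O₂
forgetᶜ I₂        = I₂
forgetᶜ (Cond _)  = Cond tt

infixl 9 _·_ _·*_ _··_
infix  10 _[_] _[_]*

data Term (C : Ty → Set) (Γ : Ctx) : Ty → Set where
  var : σ ∈ˡ Γ → Term C Γ σ
  con : C σ → Term C Γ σ
  _·_ : Term C Γ (σ ⇒ τ) → Term C Γ σ → Term C Γ τ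

-- Tuples of terms.  A tuple Terms C Δ Γ is also a substitution.

Terms : (Ty → Set) → Ctx → List Ty → Set
Terms C Γ σs = All (Term C Γ) σs

variable
  C : Ty → Set

_[_] : Term C Γ τ → Terms C Δ Γ → Term C Δ τ
var x   [ s ] = All.lookup s x
con c   [ s ] = con c
(t · u) [ s ] = t [ s ] · u [ s ]

_[_]* : Terms C Γ τs → Terms C Δ Γ → Terms C Δ τs
ts [ s ]* = All.map (_[ s ]) ts

idˢ : Terms C Γ Γ
idˢ = All.tabulate var

newˢ : ∀ σs → Terms C (σs ++ Γ) σs
newˢ σs = All.tabulate (var ∘ ∈-++⁺ˡ)

oldˢ : ∀ σs → Terms C (σs ++ Γ) Γ
oldˢ σs = All.tabulate (var ∘ ∈-++⁺ʳ σs)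

wk : ∀ σs → Term C Γ τ → Term C (σs ++ Γ) τ
wk σs t = t [ oldˢ σs ]

wk* : ∀ σs → Terms C Γ τs → Terms C (σs ++ Γ) τs
wk* σs ts = ts [ oldˢ σs ]*

lift : Terms C Δ Γ → Terms C (σ ∷ Δ) (σ ∷ Γ)
lift s = var (here refl) ∷ wk* (_ ∷ []) s

pattern v₀ = var (here refl)
pattern v₁ = var (there (here refl))
pattern v₂ = var (there (there (here refl)))

_·*_ : Term C Γ (σs ⇒* τ) → Terms C Γ σs → Term C Γ τ
t ·* []       = t
t ·* (u ∷ us) = (t · u) ·* us

_··_ : Terms C Γ (σs ⇛ τs) → Terms C Γ σs → Terms C Γ τs
fs ·· us = All.map (_·* us) (map⁻ fs)

⌜_⌝ : Term (Con HAType) Γ τ → Term Con✶ Γ τ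
⌜ var x ⌝ = var x
⌜ con c ⌝ = con (base (forgetᶜ c))
⌜ t · u ⌝ = ⌜ t ⌝ · ⌜ u ⌝

record Language : Set₁ where
  field
    Type  : Ty → Set        -- the types over which one can quantify
    Const : Ty → Set
    Rel   : List Ty → Set   -- the relation symbols other than equality

open Language

infix  7 _≐_
infixr 6 _∧_
infixr 5 _⊃_

data Formula (L : Language) (Γ : Ctx) : Set where
  _≐_ : Term (Const L) Γ σ → Term (Const L) Γ σ → Formula L Γ
  rel : Rel L σs → Terms (Const L) Γ σs → Formula L Γ
  ⊥ᶠ  : Formula L Γ
  _∧_ : Formula L Γ → Formula L Γ → Formula L Γ
  _⊃_ : Formula L Γ → Formula L Γ → Formula L Γ
  all : Type L σ → Formula L (σ ∷ Γ) → Formula L Γ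
  ex  : Type L σ → Formula L (σ ∷ Γ) → Formula L Γ

variable
  L : Language

¬ᶠ_ : Formula L Γ → Formula L Γ
¬ᶠ A = A ⊃ ⊥ᶠ

⊤ᶠ : Formula L Γ
⊤ᶠ = ⊥ᶠ ⊃ ⊥ᶠ

_[_]ᶠ : Formula L Γ → Terms (Const L) Δ Γ → Formula L Δ
(t ≐ u)    [ s ]ᶠ = t [ s ] ≐ u [ s ]
rel P ts   [ s ]ᶠ = rel P (ts [ s ]*)
⊥ᶠ         [ s ]ᶠ = ⊥ᶠ
(A₁ ∧ A₂)  [ s ]ᶠ = (A₁ [ s ]ᶠ) ∧ (A₂ [ s ]ᶠ)
(A₁ ⊃ A₂)  [ s ]ᶠ = (A₁ [ s ]ᶠ) ⊃ (A₂ [ s ]ᶠ)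
all h A    [ s ]ᶠ = all h (A [ lift s ]ᶠ)
ex h A     [ s ]ᶠ = ex h (A [ lift s ]ᶠ)

HAω : Language
HAω = record { Type = HAType ; Const = Con HAType ; Rel = λ _ → ⊥ }

data 𝓘-symbol : List Ty → Set where
  𝓘 : HAType σ → 𝓘-symbol (σ ∷ [])

𝓛ᴵ : Language
𝓛ᴵ = record { Type = HAType ; Const = Con HAType ; Rel = 𝓘-symbol }

data ∈-symbol : List Ty → Set where
  mem : ∈-symbol (σ ∷ σ ✶ ∷ [])

𝓛✶ : Language
𝓛✶ = record { Type = Any-type ; Const = Con✶ ; Rel = ∈-symbol }

Term✶ : Ctx → Ty → Set
Term✶ = Term Con✶

Terms✶ : Ctx → List Ty → Set
Terms✶ = Terms Con✶

Formula✶ : Ctx → Set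
Formula✶ = Formula 𝓛✶

_≤ᶠ_ : Term✶ Γ N → Term✶ Γ N → Formula✶ Γ
t ≤ᶠ u = ex {σ = N} tt (add (wk (N ∷ []) t) v₀ ≐ wk (N ∷ []) u)
  where
  -- x + z is R z x (Π S)
  add : Term✶ Γ N → Term✶ Γ N → Term✶ Γ N
  add x z = con (base (R {σs = N ∷ []} (tt ∷ []) (here refl))) · z · x
              · (con (base (Π {σ = N ⇒ N} {τ = N} tt tt)) · con (base S))

∀∈ : ∀ τs → Terms✶ Γ (τs ✶*) → Formula✶ (τs ++ Γ) → Formula✶ Γ
∀∈ []       []       A = A
∀∈ (τ ∷ τs) (b ∷ bs) A =
  ∀∈ τs bs (all tt (rel mem (v₀ ∷ wk (τ ∷ τs) b ∷ []) ⊃ A))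

close : Formula✶ Γ → Formula✶ []
close {Γ = []}    A = A
close {Γ = σ ∷ Γ} A = close (all tt A)

-- The structure 𝒮^ω_*.  Sets are setoids: function types are interpreted
-- by all functions, with extensional equality, and σ ✶ by non-empty
-- lists that are identified when they have the same elements.

finiteSubsets : Setoid 0ℓ 0ℓ → Setoid 0ℓ 0ℓ
finiteSubsets A = record
  { Carrier       = List⁺ (Setoid.Carrier A)
  ; _≈_           = λ X Y → toList X ⊆A toList Y × toList Y ⊆A toList X
  ; isEquivalence = record
    { refl  = id , id
    ; sym   = λ (p , q) → (λ {x} → q {x}) , (λ {x} → p {x})
    ; trans = λ (p , q) (p′ , q′) → p′ ∘ p , q ∘ q′
    }
  }
  where open import Data.List.Relation.Binary.Subset.Setoid A renaming (_⊆_ to _⊆A_)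

⟦_⟧ : Ty → Setoid 0ℓ 0ℓ
⟦ N ⟧     = ≡.setoid ℕ
⟦ B ⟧     = ≡.setoid Bool
⟦ σ ⇒ τ ⟧ = ⟦ σ ⟧ ⇨ ⟦ τ ⟧
⟦ σ ✶ ⟧   = finiteSubsets ⟦ σ ⟧

El : Ty → Set
El σ = Setoid.Carrier ⟦ σ ⟧

Envₛ : Ctx → Setoid 0ℓ 0ℓ
Envₛ []      = ≡.setoid ⊤
Envₛ (σ ∷ Γ) = ⟦ σ ⟧ ×ₛ Envₛ Γ

Env : Ctx → Set
Env Γ = Setoid.Carrier (Envₛ Γ)

infix 4 _≈_ _≈ᴱ_

_≈_ : El σ → El σ → Set
_≈_ {σ = σ} = Setoid._≈_ ⟦ σ ⟧

_≈ᴱ_ : Env Γ → Env Γ → Set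
_≈ᴱ_ {Γ = Γ} = Setoid._≈_ (Envₛ Γ)

_∈ˢ_ : El σ → El (σ ✶) → Set
_∈ˢ_ {σ = σ} x X = SetoidMembership._∈_ ⟦ σ ⟧ x (toList X)

curry : {X Y Z : Setoid 0ℓ 0ℓ} → Func (X ×ₛ Y) Z → Func X (Y ⇨ Z)
curry {X} {Y} f = record
  { to   = λ x → record
    { to   = λ y → f ⟨$⟩ (x , y)
    ; cong = λ p → Func.cong f (Setoid.refl X , p)
    }
  ; cong = λ p y → Func.cong f (p , Setoid.refl Y)
  }

curry* : {X : Setoid 0ℓ 0ℓ} → ∀ σs →
         Func (X ×ₛ Envₛ σs) ⟦ τ ⟧ → Func X ⟦ σs ⇒* τ ⟧
curry* []       f = record
  { to   = λ x → f ⟨$⟩ (x , tt)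
  ; cong = λ p → Func.cong f (p , refl)
  }
curry* (σ ∷ σs) f = curry (curry* σs record
  { to   = λ ((x , y) , ys) → f ⟨$⟩ (x , y , ys)
  ; cong = λ ((p , q) , qs) → Func.cong f (p , q , qs)
  })

apply : ∀ σs → El (σs ⇒* τ) → Env σs → El τ
apply []       f _        = f
apply (σ ∷ σs) f (x , xs) = apply σs (f ⟨$⟩ x) xs

apply-cong : ∀ σs {f g : El (σs ⇒* τ)} {xs ys : Env σs} →
             _≈_ {σs ⇒* τ} f g → _≈ᴱ_ {σs} xs ys →
             _≈_ {τ} (apply σs f xs) (apply σs g ys)
apply-cong         []       p _        = p
apply-cong {τ = τ} (σ ∷ σs) {f} {g} {x , _} p (q , qs) =
  apply-cong σs (Setoid.trans ⟦ σs ⇒* τ ⟧ (p x) (Func.cong g q)) qs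

stepAll : ∀ σs τs → Env (map (λ τ → N ⇒ σs ⇒* τ) τs) → ℕ → Env σs → Env τs
stepAll σs []       _        n xs = tt
stepAll σs (τ ∷ τs) (f , fs) n xs = apply σs (f ⟨$⟩ n) xs , stepAll σs τs fs n xs

stepAll-cong : ∀ σs τs {fs gs : Env (map (λ τ → N ⇒ σs ⇒* τ) τs)} n {xs ys} →
               _≈ᴱ_ {map (λ τ → N ⇒ σs ⇒* τ) τs} fs gs → _≈ᴱ_ {σs} xs ys →
               _≈ᴱ_ {τs} (stepAll σs τs fs n xs) (stepAll σs τs gs n ys)
stepAll-cong σs []       n _        q = refl
stepAll-cong σs (τ ∷ τs) n (p , ps) q =
  apply-cong σs (p n) q , stepAll-cong σs τs n ps q

recurse : ∀ σs → ℕ → Env σs → Env (steps σs) → Env σs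
recurse σs zero    ws fs = ws
recurse σs (suc n) ws fs = stepAll σs σs fs n (recurse σs n ws fs)

recurse-cong : ∀ σs n {ws ws′ : Env σs} {fs fs′ : Env (steps σs)} →
               _≈ᴱ_ {σs} ws ws′ → _≈ᴱ_ {steps σs} fs fs′ →
               _≈ᴱ_ {σs} (recurse σs n ws fs) (recurse σs n ws′ fs′)
recurse-cong σs zero    p q = p
recurse-cong σs (suc n) p q = stepAll-cong σs σs n q (recurse-cong σs n p q)

lookup : σ ∈ˡ Γ → Env Γ → El σ
lookup (here refl) (x , _)  = x
lookup (there i)   (_ , xs) = lookup i xs

lookup-cong : (i : σ ∈ˡ Γ) {xs ys : Env Γ} → _≈ᴱ_ {Γ} xs ys →
              _≈_ {σ} (lookup i xs) (lookup i ys)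
lookup-cong (here refl) (p , _)  = p
lookup-cong (there i)   (_ , ps) = lookup-cong i ps

constant : ∀ σs τ → Func (Envₛ σs) ⟦ τ ⟧ → El (σs ⇒* τ)
constant σs τ f = curry* {τ = τ} {X = ≡.setoid ⊤} σs record
  { to   = λ (_ , xs) → f ⟨$⟩ xs
  ; cong = λ (_ , ps) → Func.cong f ps
  } ⟨$⟩ tt

⟦_⟧ᶜ : ∀ {P} → Con P σ → El σ
⟦ Π {σ} {τ} _ _ ⟧ᶜ = constant (σ ∷ τ ∷ []) σ record
  { to = λ (x , _) → x ; cong = λ (p , _) → p }
⟦ Σ {ρ} {σ} {τ} _ _ _ ⟧ᶜ = constant ((ρ ⇒ σ ⇒ τ) ∷ (ρ ⇒ σ) ∷ ρ ∷ []) τ record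
  { to   = λ (x , y , z , _) → x ⟨$⟩ z ⟨$⟩ (y ⟨$⟩ z)
  ; cong = λ { {x , y , z , _} {x′ , y′ , z′ , _} (p , q , r , _) →
      apply-cong {τ} (ρ ∷ σ ∷ []) {f = x} {g = x′} p
        (r , Setoid.trans ⟦ σ ⟧ (q z) (Func.cong y′ r) , refl) }
  }
⟦ O ⟧ᶜ = zero
⟦ S ⟧ᶜ = record { to = suc ; cong = ≡.cong suc }
⟦ R {σs} _ i ⟧ᶜ = curry* σs (curry* (steps σs) record
  { to   = λ ((n , ws) , fs) → lookup i (recurse σs n ws fs)
  ; cong = λ { {(n , _) , _} ((refl , p) , q) →
      lookup-cong i (recurse-cong σs n p q) }
  })
⟦ O₂ ⟧ᶜ = false
⟦ I₂ ⟧ᶜ = true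
⟦ Cond {σ} _ ⟧ᶜ = constant (B ∷ σ ∷ σ ∷ []) σ record
  { to   = λ (i , x , y , _) → if i then y else x
  ; cong = λ { {false , _} (refl , p , _) → p
             ; {true  , _} (refl , _ , q , _) → q }
  }

singleton-mono : {x y : El σ} → _≈_ {σ} x y →
                 _⊆_ ⟦ σ ⟧ (toList [ x ]⁺) (toList [ y ]⁺)
singleton-mono {σ = σ} p (here q) = here (Setoid.trans ⟦ σ ⟧ q p)

union-mono : (X X′ Y Y′ : El (σ ✶)) →
             _⊆_ ⟦ σ ⟧ (toList X) (toList X′) →
             _⊆_ ⟦ σ ⟧ (toList Y) (toList Y′) →
             _⊆_ ⟦ σ ⟧ (toList (X ⁺++⁺ Y)) (toList (X′ ⁺++⁺ Y′))
union-mono {σ = σ} X X′ Y Y′ p q r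
  with Membershipₚ.∈-++⁻ ⟦ σ ⟧ (toList X) r
... | inj₁ i = Membershipₚ.∈-++⁺ˡ ⟦ σ ⟧ (p i)
... | inj₂ i = Membershipₚ.∈-++⁺ʳ ⟦ σ ⟧ (toList X′) (q i)

⋃-mono : (X Y : El (σ ✶)) (f g : El (σ ⇒ τ ✶)) →
         _⊆_ ⟦ σ ⟧ (toList X) (toList Y) → _≈_ {σ ⇒ τ ✶} f g →
         _⊆_ ⟦ τ ⟧ (toList (concatMap (f ⟨$⟩_) X)) (toList (concatMap (g ⟨$⟩_) Y))
⋃-mono {σ = σ} {τ = τ} X Y f g p q {w} r =
  let x , x∈X , w∈fx = find (Anyₚ.map⁻ {f = f ⟨$⟩_} {xs = toList X}
                         (Anyₚ.map⁻ {f = toList} (Anyₚ.concat⁻ _ r)))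
      w∈fY = lose {P = λ y → w ∈τ toList (f ⟨$⟩ y)}
               (λ u≈v i → proj₁ (Func.cong f u≈v) i) (p x∈X) w∈fx
  in Anyₚ.concat⁺ (Anyₚ.map⁺ {f = toList} (Anyₚ.map⁺ {f = g ⟨$⟩_}
       (Any.map (λ {y} i → proj₁ (q y) i) w∈fY)))
  where
  open SetoidMembership ⟦ σ ⟧ using (find; lose)
  open SetoidMembership ⟦ τ ⟧ using () renaming (_∈_ to _∈τ_)

maximum : List⁺ ℕ → ℕ
maximum X = max 0 (toList X)

⟦_⟧ᶜ✶ : Con✶ σ → El σ
⟦ base c ⟧ᶜ✶ = ⟦ c ⟧ᶜ
⟦ singleton {σ} ⟧ᶜ✶ = record
  { to   = [_]⁺
  ; cong = λ p → singleton-mono {σ} p , singleton-mono {σ} (Setoid.sym ⟦ σ ⟧ p)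
  }
⟦ union {σ} ⟧ᶜ✶ = constant (σ ✶ ∷ σ ✶ ∷ []) (σ ✶) record
  { to   = λ (X , Y , _) → X ⁺++⁺ Y
  ; cong = λ { {X , Y , _} {X′ , Y′ , _} ((p , p′) , (q , q′) , _) →
      union-mono {σ} X X′ Y Y′ p q , union-mono {σ} X′ X Y′ Y p′ q′ }
  }
⟦ ⋃ {σ} {τ} ⟧ᶜ✶ = constant (σ ✶ ∷ (σ ⇒ τ ✶) ∷ []) (τ ✶) record
  { to   = λ (X , f , _) → concatMap (f ⟨$⟩_) X
  ; cong = λ { {X , f , _} {Y , g , _} ((p , p′) , q , _) →
      ⋃-mono {σ} {τ} X Y f g p q ,
      ⋃-mono {σ} {τ} Y X g f p′ (Setoid.sym ⟦ σ ⇒ τ ✶ ⟧ {f} {g} q) }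
  }
⟦ m ⟧ᶜ✶ = record
  { to   = maximum
  ; cong = λ (p , q) → ℕₚ.≤-antisym (max-mono-⊆ ℕₚ.≤-refl p) (max-mono-⊆ ℕₚ.≤-refl q)
  }

⟦_⟧ᵗ : Term✶ Γ τ → Env Γ → El τ
⟦ var x ⟧ᵗ γ = lookup x γ
⟦ con c ⟧ᵗ γ = ⟦ c ⟧ᶜ✶
⟦ t · u ⟧ᵗ γ = ⟦ t ⟧ᵗ γ ⟨$⟩ ⟦ u ⟧ᵗ γ

infix 3 _⊨_

_⊨_ : Env Γ → Formula✶ Γ → Set
γ ⊨ _≐_ {σ} t u                = _≈_ {σ} (⟦ t ⟧ᵗ γ) (⟦ u ⟧ᵗ γ)
γ ⊨ rel (mem {σ}) (t ∷ u ∷ []) = _∈ˢ_ {σ} (⟦ t ⟧ᵗ γ) (⟦ u ⟧ᵗ γ)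
γ ⊨ ⊥ᶠ                         = ⊥
γ ⊨ A₁ ∧ A₂                    = (γ ⊨ A₁) × (γ ⊨ A₂)
γ ⊨ A₁ ⊃ A₂                    = γ ⊨ A₁ → γ ⊨ A₂
γ ⊨ all {σ} _ A                = (x : El σ) → x , γ ⊨ A
γ ⊨ ex {σ} _ A                 = ∃ λ (x : El σ) → x , γ ⊨ A

-- The target theory.  Being the set of all true sentences, it is closed
-- under deduction, so T A also says that A is derivable from it.

T : Formula✶ [] → Set
T A = tt ⊨ A

record WitnessTypes : Set where
  constructor _,_
  field
    pos neg : List Ty

open WitnessTypes

IsWitnessing : WitnessTypes → Set
IsWitnessing W = All Witnessing (pos W) × All Witnessing (neg W)

noneᵂ : WitnessTypes
noneᵂ = [] , []

_∧ᵂ_ : WitnessTypes → WitnessTypes → WitnessTypes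
V ∧ᵂ W = (pos V ++ pos W) , (neg V ++ neg W)

_⊃ᵂ_ : WitnessTypes → WitnessTypes → WitnessTypes
V ⊃ᵂ W = ((pos V ⇛ pos W) ++ (pos V ⇛ neg W ⇛ neg V ✶*)) , (pos V ++ neg W)

exᵂ : WitnessTypes → WitnessTypes
exᵂ W = pos W , neg W ✶*

⇒*-witnessing : All Witnessing σs → Witnessing τ → Witnessing (σs ⇒* τ)
⇒*-witnessing []       w = w
⇒*-witnessing (v ∷ vs) w = v ⇒ ⇒*-witnessing vs w

⇛-witnessing : All Witnessing σs → All Witnessing τs → All Witnessing (σs ⇛ τs)
⇛-witnessing vs ws = map⁺ (All.map (⇒*-witnessing vs) ws)

✶*-witnessing : All Witnessing σs → All Witnessing (σs ✶*)
✶*-witnessing vs = map⁺ (All.map _✶ vs)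

∧ᵂ-witnessing : ∀ {V W} → IsWitnessing V → IsWitnessing W → IsWitnessing (V ∧ᵂ W)
∧ᵂ-witnessing (p , n) (p′ , n′) = ++⁺ p p′ , ++⁺ n n′

⊃ᵂ-witnessing : ∀ {V W} → IsWitnessing V → IsWitnessing W → IsWitnessing (V ⊃ᵂ W)
⊃ᵂ-witnessing (p , n) (p′ , n′) =
  ++⁺ (⇛-witnessing p p′) (⇛-witnessing p (⇛-witnessing n′ (✶*-witnessing n))) ,
  ++⁺ p n′

-- ⟨𝓘 h (x)⟩ with positive witnesses a and negative witnesses b is the
-- formula with free variables x, a, b.  Equality always has the
-- interpretation by itself, without witnesses.

record BaseInterpretation : Set where
  field
    wit        : HAType σ → WitnessTypes
    witnessing : (h : HAType σ) → IsWitnessing (wit h)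
    formula    : (h : HAType σ) → Formula✶ (σ ∷ pos (wit h) ++ neg (wit h))

-- The 𝒰-interpretation.  The formula A has its free variables in Γ; they
-- are replaced by the terms s, the positive and negative witnesses by the
-- terms a and b.

module 𝒰 (𝓑 : BaseInterpretation) where
  open BaseInterpretation 𝓑 renaming (wit to wit𝓘; witnessing to wit𝓘-witnessing)

  wit : Formula 𝓛ᴵ Γ → WitnessTypes
  wit (t ≐ u)       = noneᵂ
  wit (rel (𝓘 h) _) = wit𝓘 h
  wit ⊥ᶠ            = noneᵂ
  wit (A₁ ∧ A₂)     = wit A₁ ∧ᵂ wit A₂
  wit (A₁ ⊃ A₂)     = wit A₁ ⊃ᵂ wit A₂
  wit (all _ A)     = wit A
  wit (ex _ A)      = exᵂ (wit A)

  -- Terms of types pos (wit A), neg (wit A) are witnessing terms.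

  wit-witnessing : (A : Formula 𝓛ᴵ Γ) → IsWitnessing (wit A)
  wit-witnessing (t ≐ u)       = [] , []
  wit-witnessing (rel (𝓘 h) _) = wit𝓘-witnessing h
  wit-witnessing ⊥ᶠ            = [] , []
  wit-witnessing (A₁ ∧ A₂)     = ∧ᵂ-witnessing (wit-witnessing A₁) (wit-witnessing A₂)
  wit-witnessing (A₁ ⊃ A₂)     = ⊃ᵂ-witnessing (wit-witnessing A₁) (wit-witnessing A₂)
  wit-witnessing (all _ A)     = wit-witnessing A
  wit-witnessing (ex _ A)      = map₂ ✶*-witnessing (wit-witnessing A)

  ⟨_⟩ : (A : Formula 𝓛ᴵ Γ) → Terms✶ Δ Γ →
        Terms✶ Δ (pos (wit A)) → Terms✶ Δ (neg (wit A)) → Formula✶ Δ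
  ⟨ t ≐ u ⟩ s a b = ⌜ t ⌝ [ s ] ≐ ⌜ u ⌝ [ s ]
  ⟨ rel (𝓘 h) (t ∷ []) ⟩ s a b = formula h [ ⌜ t ⌝ [ s ] ∷ ++⁺ a b ]ᶠ
  ⟨ ⊥ᶠ ⟩ s a b = ⊥ᶠ
  ⟨ A₁ ∧ A₂ ⟩ s ac bd =
    let a , c = ++⁻ (pos (wit A₁)) ac
        b , d = ++⁻ (neg (wit A₁)) bd
    in ⟨ A₁ ⟩ s a b ∧ ⟨ A₂ ⟩ s c d
  ⟨ A₁ ⊃ A₂ ⟩ s fg ad =
    let f , g = ++⁻ (pos (wit A₁) ⇛ pos (wit A₂)) fg
        a , d = ++⁻ (pos (wit A₁)) ad
        βs    = neg (wit A₁)
    in ∀∈ βs (g ·· a ·· d) (⟨ A₁ ⟩ (wk* βs s) (wk* βs a) (newˢ βs))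
       ⊃ ⟨ A₂ ⟩ s (f ·· a) d
  ⟨ all {σ} _ A ⟩ s a b =
    all tt (⟨ A ⟩ (lift s) (wk* (σ ∷ []) a) (wk* (σ ∷ []) b))
  ⟨ ex {σ} _ A ⟩ s a bs =
    let βs = neg (wit A)
    in ex tt (∀∈ βs (wk* (σ ∷ []) bs)
         (⟨ A ⟩ (wk* βs (lift s)) (wk* βs (wk* (σ ∷ []) a)) (newˢ βs)))

  𝒰-interpretable : Formula 𝓛ᴵ Γ → Set
  𝒰-interpretable {Γ} A =
    ∃ λ (t : Terms✶ [] (pos (wit A))) →
      T (close {Γ = neg (wit A) ++ Γ}
          (⟨ A ⟩ (oldˢ (neg (wit A))) (t [ [] ]*) (newˢ (neg (wit A)))))

𝓘ᶠ : HAType σ → Term (Con HAType) Γ σ → Formula 𝓛ᴵ Γ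
𝓘ᶠ h t = rel (𝓘 h) (t ∷ [])

_ᴵ : Formula HAω Γ → Formula 𝓛ᴵ Γ
(t ≐ u) ᴵ   = t ≐ u
⊥ᶠ ᴵ        = ⊥ᶠ
(A₁ ∧ A₂) ᴵ = (A₁ ᴵ) ∧ (A₂ ᴵ)
(A₁ ⊃ A₂) ᴵ = (A₁ ᴵ) ⊃ (A₂ ᴵ)
all h A ᴵ   = all h (𝓘ᶠ h v₀ ⊃ (A ᴵ))
ex h A ᴵ    = ex h (𝓘ᶠ h v₀ ∧ (A ᴵ))

-- For a tuple x, the prefix ∀x(𝓘(x) → …) is the iterated relativized
-- quantifier.

closeᴵ : All HAType Γ → Formula 𝓛ᴵ Γ → Formula 𝓛ᴵ []
closeᴵ []       A = A
closeᴵ (h ∷ hs) A = closeᴵ hs (all h (𝓘ᶠ h v₀ ⊃ A))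

private
  Tm : Ctx → Ty → Set
  Tm = Term (Con HAType)

  Tms : Ctx → List Ty → Set
  Tms = Terms (Con HAType)

recᵗ : All HAType σs → τ ∈ˡ σs → Tm Γ N → Tms Γ σs → Tms Γ (steps σs) → Tm Γ τ
recᵗ {σs} hs i n w f = (_·*_ {σs = σs} (con (R hs i) · n) w) ·* f

stepᵗ : ∀ σs → τ ∈ˡ σs → Tms Γ (steps σs) → Tm Γ N → Tms Γ σs → Tm Γ τ
stepᵗ σs i f n u = (All.lookup (map⁻ f) i · n) ·* u

data Axiom : Formula HAω Γ → Set where

  ≐-refl : Axiom {σ ∷ []} (v₀ ≐ v₀)

  ≐-subst : (D : Formula HAω (σ ∷ Γ)) →
            Axiom {σ ∷ σ ∷ Γ} (v₁ ≐ v₀ ∧ (D [ v₁ ∷ oldˢ (σ ∷ σ ∷ []) ]ᶠ)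
                               ⊃ (D [ v₀ ∷ oldˢ (σ ∷ σ ∷ []) ]ᶠ))

  Π-axiom : (hσ : HAType σ) (hτ : HAType τ) →
            Axiom {σ ∷ τ ∷ []} (con (Π hσ hτ) · v₀ · v₁ ≐ v₀)

  Σ-axiom : (hρ : HAType ρ) (hσ : HAType σ) (hτ : HAType τ) →
            Axiom {(ρ ⇒ σ ⇒ τ) ∷ (ρ ⇒ σ) ∷ ρ ∷ []}
              (con (Σ hρ hσ hτ) · v₀ · v₁ · v₂ ≐ v₀ · v₂ · (v₁ · v₂))

  S-injective : Axiom {N ∷ N ∷ []} (con S · v₀ ≐ con S · v₁ ⊃ v₀ ≐ v₁)

  S-nonzero : Axiom {N ∷ []} (¬ᶠ (con S · v₀ ≐ con O))

  R-zero : (hs : All HAType σs) (i : τ ∈ˡ σs) →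
           let w = newˢ σs
               f = oldˢ σs
           in Axiom {σs ++ steps σs} (recᵗ hs i (con O) w f ≐ All.lookup w i)

  R-suc : (hs : All HAType σs) (i : τ ∈ˡ σs) →
          let n = v₀
              w = wk* (N ∷ []) (newˢ σs)
              f = wk* (N ∷ []) (oldˢ σs)
          in Axiom {N ∷ σs ++ steps σs}
               (recᵗ hs i (con S · n) w f
                ≐ stepᵗ σs i f n (All.tabulate (λ j → recᵗ hs j n w f)))

  O₂≢I₂ : Axiom {[]} (¬ᶠ (con O₂ ≐ con I₂))

  B-cases : (D : Formula HAω (B ∷ Γ)) →
            Axiom ((D [ con O₂ ∷ idˢ ]ᶠ) ∧ (D [ con I₂ ∷ idˢ ]ᶠ) ⊃ all B D)

  Cond-0 : (h : HAType σ) →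
           Axiom {σ ∷ σ ∷ []} (con (Cond h) · con O₂ · v₀ · v₁ ≐ v₀)

  Cond-1 : (h : HAType σ) →
           Axiom {σ ∷ σ ∷ []} (con (Cond h) · con I₂ · v₀ · v₁ ≐ v₁)

  induction : (D : Formula HAω (N ∷ Γ)) →
              Axiom ((D [ con O ∷ idˢ ]ᶠ)
                     ∧ all N (D ⊃ (D [ con S · v₀ ∷ oldˢ (N ∷ []) ]ᶠ))
                     ⊃ all N D)

record SoundTypeInformative (𝓑 : BaseInterpretation) : Set where
  open 𝒰 𝓑

  𝓘-interpretable : All HAType Γ → Formula HAω Γ → Set
  𝓘-interpretable hs A = 𝒰-interpretable (closeᴵ hs (A ᴵ))

  field
    constants   : (h : HAType σ) (c : Con HAType σ) →
                  𝒰-interpretable {[]} (𝓘ᶠ h (con c))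
    application : (hσ : HAType σ) (hτ : HAType τ) →
                  𝒰-interpretable {[]}
                    (all hσ (all (hσ ⇒ hτ)
                      (𝓘ᶠ hσ v₁ ∧ 𝓘ᶠ (hσ ⇒ hτ) v₀ ⊃ 𝓘ᶠ hτ (v₀ · v₁))))
    axioms      : (hs : All HAType Γ) {A : Formula HAω Γ} → Axiom A →
                  𝓘-interpretable hs A

witᶜᵇ : HAType σ → WitnessTypes
witᶜᵇ N       = (N ∷ []) , []
witᶜᵇ B       = noneᵂ
witᶜᵇ (h ⇒ k) = witᶜᵇ h ⊃ᵂ witᶜᵇ k

witᶜᵇ-witnessing : (h : HAType σ) → IsWitnessing (witᶜᵇ h)
witᶜᵇ-witnessing N       = (N ∷ []) , []
witᶜᵇ-witnessing B       = [] , []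
witᶜᵇ-witnessing (h ⇒ k) = ⊃ᵂ-witnessing (witᶜᵇ-witnessing h) (witᶜᵇ-witnessing k)

formulaᶜᵇ : (h : HAType σ) → Term✶ Δ σ →
            Terms✶ Δ (pos (witᶜᵇ h)) → Terms✶ Δ (neg (witᶜᵇ h)) → Formula✶ Δ
formulaᶜᵇ N x (n ∷ []) [] = x ≤ᶠ n
formulaᶜᵇ B i [] [] = ⊤ᶠ
formulaᶜᵇ {σ = ρ ⇒ σ} (h ⇒ k) t fg ad =
  let f , g = ++⁻ (pos (witᶜᵇ h) ⇛ pos (witᶜᵇ k)) (wk* (ρ ∷ []) fg)
      a , d = ++⁻ (pos (witᶜᵇ h)) (wk* (ρ ∷ []) ad)
      βs    = neg (witᶜᵇ h)
  in all tt (∀∈ βs (g ·· a ·· d) (formulaᶜᵇ h (wk βs v₀) (wk* βs a) (newˢ βs))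
             ⊃ formulaᶜᵇ k (wk (ρ ∷ []) t · v₀) (f ·· a) d)

𝓘ᶜᵇ : BaseInterpretation
𝓘ᶜᵇ = record
  { wit        = witᶜᵇ
  ; witnessing = witᶜᵇ-witnessing
  ; formula    = λ h →
      let a , b = ++⁻ (pos (witᶜᵇ h)) (wk* (_ ∷ []) idˢ)
      in formulaᶜᵇ h v₀ a b
  }

{-# OPTIONS --safe #-}
module Submission where

-- Formulas denote predicates on an environment, positive and negative
-- witnesses.  P ⊢ Q means that terms turn witnesses of P into
-- witnesses of Q and challenges to Q into finite sets of challenges to P,
-- uniformly in the environment.  This entailment satisfies the rules for
-- ∧, ⊃ and ∀, and 𝓘 at ρ ⇒ σ is literally ∀x(𝓘(x) ⊃ 𝓘(hx)), so that the
-- conditions on combinators and application are intuitionistic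
-- derivations.  Positive witnesses are monotone (for ≤ on ℕ, inclusion of
-- sets, pointwise at function types), and any two have an upper bound.
-- Hence one witness serves both Boolean values, which carry no witness
-- themselves, and one witness serves all n ≤ k, which gives induction and
-- thereby the recursors.

open import Defs
open import Data.Bool.Base using (Bool; true; false)
open import Data.Empty using (⊥)
open import Data.List.Base using (List; []; _∷_; _++_; map)
open import Data.List.Extrema.Nat using (xs≤max)
open import Data.List.Membership.Propositional using () renaming (_∈_ to _∈ˡ_)
open import Data.List.Membership.Propositional.Properties using (∈-++⁺ˡ; ∈-++⁺ʳ)
import Data.List.Membership.Setoid.Properties as Membershipₚ
open import Data.List.NonEmpty.Base using (toList; head)
open import Data.List.Relation.Unary.All as All using (All; []; _∷_)
open import Data.List.Relation.Unary.All.Properties using (++⁺; ++⁻; lookup-map; map⁺; map⁻)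
import Data.List.Relation.Unary.Any as Any
open import Data.List.Relation.Unary.Any using (here; there)
import Data.List.Relation.Unary.Any.Properties as Anyₚ
open import Data.Nat.Base using (ℕ; zero; suc; _+_; _∸_; _≤_; z≤n; s≤s)
import Data.Nat.Properties as ℕₚ
open import Data.Product.Base using (∃; _×_; _,_; proj₁; proj₂; map₂)
open import Data.Product.Function.NonDependent.Propositional using (_×-⇔_)
open import Data.Sum.Base using (inj₁; inj₂)
open import Data.Unit.Base using (⊤; tt)
open import Function.Base using (_∘_; id; case_of_)
open import Function.Bundles using (Func; _⟨$⟩_; _⇔_; mk⇔; Equivalence)
open import Function.Construct.Composition using (_⇔-∘_)
open import Function.Related.TypeIsomorphisms using (→-cong-⇔)
open import Relation.Binary.Bundles using (Setoid)
open import Relation.Binary.PropositionalEquality using (_≡_; refl; sym; trans; cong; cong₂; subst; subst₂)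

open WitnessTypes

-- Tuples

-- The witnessing terms never receive the values of the free variables. This makes the rules for ∀
-- immediate and is the obstacle everywhere else: no term can inspect a Boolean, or recurse on the
-- number n of an induction, of which it knows only a bound k. An upper bound of all candidates
-- replaces the choice between them. The plain pointwise order suffices for this, without hereditary
-- monotonicity of functionals, because two witnesses of an implication are compared at the same
-- witness of its premise. Challenges cannot be selected either, since satisfaction is read
-- constructively and is not decidable in general; several challenges to one premise are united
-- instead. Enlarging a set of challenges only strengthens the premise, so generous
-- over-approximations are harmless. Only the witnesses have to be terms. The truth conditions are
-- treated as predicates over the structure, so that no derivation inside the target language is
-- carried out.

⟦_⟧* : Terms✶ Γ τs → Env Γ → Env τs
⟦ [] ⟧*     γ = tt
⟦ t ∷ ts ⟧* γ = ⟦ t ⟧ᵗ γ , ⟦ ts ⟧* γ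

append : ∀ σs τs → Env σs → Env τs → Env (σs ++ τs)
append []       τs _        ys = ys
append (_ ∷ σs) τs (x , xs) ys = x , append σs τs xs ys

take : ∀ σs τs → Env (σs ++ τs) → Env σs
take []       τs _        = tt
take (_ ∷ σs) τs (x , xs) = x , take σs τs xs

drop : ∀ σs τs → Env (σs ++ τs) → Env τs
drop []       τs xs       = xs
drop (_ ∷ σs) τs (_ , xs) = drop σs τs xs

take-append : ∀ σs τs (xs : Env σs) (ys : Env τs) → take σs τs (append σs τs xs ys) ≡ xs
take-append []       τs _        ys = refl
take-append (_ ∷ σs) τs (x , xs) ys = cong (x ,_) (take-append σs τs xs ys)

drop-append : ∀ σs τs (xs : Env σs) (ys : Env τs) → drop σs τs (append σs τs xs ys) ≡ ys
drop-append []       τs _        ys = refl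
drop-append (_ ∷ σs) τs (_ , xs) ys = drop-append σs τs xs ys

applyAll : ∀ σs τs → Env (σs ⇛ τs) → Env σs → Env τs
applyAll σs []       _        xs = tt
applyAll σs (τ ∷ τs) (f , fs) xs = apply σs f xs , applyAll σs τs fs xs

lookup-take : ∀ σs Γ (i : σ ∈ˡ σs) (γ : Env (σs ++ Γ)) →
              lookup (∈-++⁺ˡ i) γ ≡ lookup i (take σs Γ γ)
lookup-take (_ ∷ _)  Γ (here refl) _       = refl
lookup-take (_ ∷ σs) Γ (there i)   (_ , γ) = lookup-take σs Γ i γ

lookup-drop : ∀ σs Γ (i : σ ∈ˡ Γ) (γ : Env (σs ++ Γ)) →
              lookup (∈-++⁺ʳ σs i) γ ≡ lookup i (drop σs Γ γ)
lookup-drop []       Γ i _       = refl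
lookup-drop (_ ∷ σs) Γ i (_ , γ) = lookup-drop σs Γ i γ

-- Terms

⟦lookup⟧ : (ts : Terms✶ Γ τs) (i : τ ∈ˡ τs) (γ : Env Γ) →
           ⟦ All.lookup ts i ⟧ᵗ γ ≡ lookup i (⟦ ts ⟧* γ)
⟦lookup⟧ (t ∷ ts) (here refl) γ = refl
⟦lookup⟧ (t ∷ ts) (there i)   γ = ⟦lookup⟧ ts i γ

⟦tabulate⟧ : ∀ {τs} (t : ∀ {τ} → τ ∈ˡ τs → Term✶ Γ τ) (γ : Env Γ) (xs : Env τs) →
             (∀ {τ} (i : τ ∈ˡ τs) → ⟦ t i ⟧ᵗ γ ≡ lookup i xs) →
             ⟦ All.tabulate t ⟧* γ ≡ xs
⟦tabulate⟧ {τs = []}    t γ _        h = refl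
⟦tabulate⟧ {τs = _ ∷ _} t γ (x , xs) h =
  cong₂ _,_ (h (here refl)) (⟦tabulate⟧ (t ∘ there) γ xs (h ∘ there))

⟦newˢ⟧ : ∀ σs Γ (γ : Env (σs ++ Γ)) → ⟦ newˢ {Γ = Γ} σs ⟧* γ ≡ take σs Γ γ
⟦newˢ⟧ σs Γ γ = ⟦tabulate⟧ (var ∘ ∈-++⁺ˡ) γ (take σs Γ γ) (λ i → lookup-take σs Γ i γ)

⟦oldˢ⟧ : ∀ σs Γ (γ : Env (σs ++ Γ)) → ⟦ oldˢ {Γ = Γ} σs ⟧* γ ≡ drop σs Γ γ
⟦oldˢ⟧ σs Γ γ = ⟦tabulate⟧ (var ∘ ∈-++⁺ʳ σs) γ (drop σs Γ γ) (λ i → lookup-drop σs Γ i γ)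

⟦idˢ⟧ : ∀ Γ (γ : Env Γ) → ⟦ idˢ {Γ = Γ} ⟧* γ ≡ γ
⟦idˢ⟧ Γ γ = ⟦tabulate⟧ var γ γ (λ _ → refl)

⟦sub⟧ : (t : Term✶ Γ τ) (s : Terms✶ Δ Γ) (γ : Env Δ) → ⟦ t [ s ] ⟧ᵗ γ ≡ ⟦ t ⟧ᵗ (⟦ s ⟧* γ)
⟦sub⟧ (var i) s γ = ⟦lookup⟧ s i γ
⟦sub⟧ (con c) s γ = refl
⟦sub⟧ (t · u) s γ = cong₂ _⟨$⟩_ (⟦sub⟧ t s γ) (⟦sub⟧ u s γ)

⟦sub⟧* : (ts : Terms✶ Γ τs) (s : Terms✶ Δ Γ) (γ : Env Δ) → ⟦ ts [ s ]* ⟧* γ ≡ ⟦ ts ⟧* (⟦ s ⟧* γ)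
⟦sub⟧* []       s γ = refl
⟦sub⟧* (t ∷ ts) s γ = cong₂ _,_ (⟦sub⟧ t s γ) (⟦sub⟧* ts s γ)

⟦wk⟧ : ∀ σs (t : Term✶ Γ τ) (γ : Env (σs ++ Γ)) → ⟦ wk σs t ⟧ᵗ γ ≡ ⟦ t ⟧ᵗ (drop σs Γ γ)
⟦wk⟧ {Γ} σs t γ = trans (⟦sub⟧ t (oldˢ σs) γ) (cong ⟦ t ⟧ᵗ (⟦oldˢ⟧ σs Γ γ))

⟦wk⟧* : ∀ σs (ts : Terms✶ Γ τs) (γ : Env (σs ++ Γ)) →
        ⟦ wk* σs ts ⟧* γ ≡ ⟦ ts ⟧* (drop σs Γ γ)
⟦wk⟧* {Γ} σs ts γ = trans (⟦sub⟧* ts (oldˢ σs) γ) (cong ⟦ ts ⟧* (⟦oldˢ⟧ σs Γ γ))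

⟦lift⟧ : (s : Terms✶ Δ Γ) (x : El σ) (γ : Env Δ) → ⟦ lift {σ = σ} s ⟧* (x , γ) ≡ (x , ⟦ s ⟧* γ)
⟦lift⟧ s x γ = cong (x ,_) (⟦wk⟧* (_ ∷ []) s (x , γ))

⟦++⁺⟧ : (ss : Terms✶ Γ σs) (ts : Terms✶ Γ τs) (γ : Env Γ) →
        ⟦ ++⁺ ss ts ⟧* γ ≡ append σs τs (⟦ ss ⟧* γ) (⟦ ts ⟧* γ)
⟦++⁺⟧ []       ts γ = refl
⟦++⁺⟧ (s ∷ ss) ts γ = cong (_ ,_) (⟦++⁺⟧ ss ts γ)

⟦++⁻⟧ˡ : ∀ σs (ts : Terms✶ Γ (σs ++ τs)) (γ : Env Γ) →
         ⟦ proj₁ (++⁻ σs ts) ⟧* γ ≡ take σs τs (⟦ ts ⟧* γ)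
⟦++⁻⟧ˡ []       ts       γ = refl
⟦++⁻⟧ˡ (_ ∷ σs) (t ∷ ts) γ = cong (_ ,_) (⟦++⁻⟧ˡ σs ts γ)

⟦++⁻⟧ʳ : ∀ σs (ts : Terms✶ Γ (σs ++ τs)) (γ : Env Γ) →
         ⟦ proj₂ (++⁻ σs ts) ⟧* γ ≡ drop σs τs (⟦ ts ⟧* γ)
⟦++⁻⟧ʳ []       ts       γ = refl
⟦++⁻⟧ʳ (_ ∷ σs) (t ∷ ts) γ = ⟦++⁻⟧ʳ σs ts γ

⟦·*⟧ : (t : Term✶ Γ (σs ⇒* τ)) (us : Terms✶ Γ σs) (γ : Env Γ) →
       ⟦ t ·* us ⟧ᵗ γ ≡ apply σs (⟦ t ⟧ᵗ γ) (⟦ us ⟧* γ)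
⟦·*⟧ t []       γ = refl
⟦·*⟧ t (u ∷ us) γ = ⟦·*⟧ (t · u) us γ

⟦··⟧ : ∀ τs (ts : Terms✶ Γ (σs ⇛ τs)) (us : Terms✶ Γ σs) (γ : Env Γ) →
       ⟦ _··_ {σs = σs} {τs = τs} ts us ⟧* γ ≡ applyAll σs τs (⟦ ts ⟧* γ) (⟦ us ⟧* γ)
⟦··⟧ []       []       us γ = refl
⟦··⟧ (_ ∷ τs) (t ∷ ts) us γ = cong₂ _,_ (⟦·*⟧ t us γ) (⟦··⟧ τs ts us γ)

-- `⌜_⌝` acts on single terms, so the substitution enters through the values of its entries.
⟦⌜sub⌝⟧ : ∀ (t : Term (Con HAType) Γ τ) (s : Terms (Con HAType) Δ Γ) (γ : Env Δ) (δ : Env Γ) →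
          (∀ {σ} (i : σ ∈ˡ Γ) → ⟦ ⌜ All.lookup s i ⌝ ⟧ᵗ γ ≡ lookup i δ) →
          ⟦ ⌜ t [ s ] ⌝ ⟧ᵗ γ ≡ ⟦ ⌜ t ⌝ ⟧ᵗ δ
⟦⌜sub⌝⟧ (var i) s γ δ h = h i
⟦⌜sub⌝⟧ (con c) s γ δ h = refl
⟦⌜sub⌝⟧ (t · u) s γ δ h = cong₂ _⟨$⟩_ (⟦⌜sub⌝⟧ t s γ δ h) (⟦⌜sub⌝⟧ u s γ δ h)

⟦⟧-cong : (t : Term✶ Γ τ) {γ δ : Env Γ} → _≈ᴱ_ {Γ} γ δ → _≈_ {τ} (⟦ t ⟧ᵗ γ) (⟦ t ⟧ᵗ δ)
⟦⟧-cong         (var i) p = lookup-cong i p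
⟦⟧-cong {τ = τ} (con c) p = Setoid.refl ⟦ τ ⟧
⟦⟧-cong {τ = τ} (t · u) {γ} {δ} p =
  Setoid.trans ⟦ τ ⟧ (⟦⟧-cong t p (⟦ u ⟧ᵗ γ)) (Func.cong (⟦ t ⟧ᵗ δ) (⟦⟧-cong u p))

-- Abstraction

-- Bracket abstraction with Π as K and Σ as S. The identity is S K K, where the argument type of the
-- inner constant function is arbitrary; `N` is chosen.
ƛ : Term✶ (σ ∷ Γ) τ → Term✶ Γ (σ ⇒ τ)
ƛ (var (here refl)) = con (base (Σ tt tt tt)) · con (base (Π tt tt)) · con (base (Π {τ = N} tt tt))
ƛ (var (there i))   = con (base (Π tt tt)) · var i
ƛ (con c)           = con (base (Π tt tt)) · con c
ƛ (t · u)           = con (base (Σ tt tt tt)) · ƛ t · ƛ u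

-- Stated after application to `x`, because only then do the two sides agree up to `≡`; as functions
-- with congruence proofs they need not.
⟦ƛ⟧ : (t : Term✶ (σ ∷ Γ) τ) (γ : Env Γ) (x : El σ) → ⟦ ƛ t ⟧ᵗ γ ⟨$⟩ x ≡ ⟦ t ⟧ᵗ (x , γ)
⟦ƛ⟧ (var (here refl)) γ x = refl
⟦ƛ⟧ (var (there i))   γ x = refl
⟦ƛ⟧ (con c)           γ x = refl
⟦ƛ⟧ (t · u)           γ x = cong₂ _⟨$⟩_ (⟦ƛ⟧ t γ x) (⟦ƛ⟧ u γ x)

-- In the curried type `σ` is the first argument, hence the last variable to be abstracted. It has
-- to be moved behind `σs` before these are abstracted.
rotate : ∀ σ σs → Terms✶ (σs ++ σ ∷ Γ) (σ ∷ σs ++ Γ)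
rotate σ σs = wk σs v₀ ∷ ++⁺ (newˢ σs) (wk* σs (oldˢ (σ ∷ [])))

⟦rotate⟧ : ∀ σ σs Γ (x : El σ) (xs : Env σs) (γ : Env Γ) →
           ⟦ rotate {Γ = Γ} σ σs ⟧* (append σs (σ ∷ Γ) xs (x , γ)) ≡ (x , append σs Γ xs γ)
⟦rotate⟧ σ σs Γ x xs γ =
  let δ = append σs (σ ∷ Γ) xs (x , γ)
      old = oldˢ {Γ = Γ} (σ ∷ [])
      eq = drop-append σs (σ ∷ Γ) xs (x , γ)
  in cong₂ _,_
       (trans (⟦wk⟧ {Γ = σ ∷ Γ} σs v₀ δ) (cong proj₁ eq))
       (trans (⟦++⁺⟧ (newˢ σs) (wk* σs old) δ)
         (cong₂ (append σs Γ)
           (trans (⟦newˢ⟧ σs (σ ∷ Γ) δ) (take-append σs (σ ∷ Γ) xs (x , γ)))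
           (trans (⟦wk⟧* σs old δ)
             (trans (cong ⟦ old ⟧* eq) (⟦oldˢ⟧ (σ ∷ []) Γ (x , γ))))))

ƛ* : ∀ σs → Term✶ (σs ++ Γ) τ → Term✶ Γ (σs ⇒* τ)
ƛ* []       t = t
ƛ* (σ ∷ σs) t = ƛ (ƛ* σs (t [ rotate σ σs ]))

⟦ƛ*⟧ : ∀ σs (t : Term✶ (σs ++ Γ) τ) (γ : Env Γ) (xs : Env σs) →
       apply σs (⟦ ƛ* σs t ⟧ᵗ γ) xs ≡ ⟦ t ⟧ᵗ (append σs Γ xs γ)
⟦ƛ*⟧ []       t γ _        = refl
⟦ƛ*⟧ {Γ} (σ ∷ σs) t γ (x , xs) =
  trans (cong (λ f → apply σs f xs) (⟦ƛ⟧ (ƛ* σs (t [ rotate σ σs ])) γ x))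
    (trans (⟦ƛ*⟧ σs (t [ rotate σ σs ]) (x , γ) xs)
      (trans (⟦sub⟧ t (rotate σ σs) (append σs (σ ∷ Γ) xs (x , γ))) (cong ⟦ t ⟧ᵗ (⟦rotate⟧ σ σs Γ x xs γ))))

ƛᵃ : ∀ σs → Terms✶ (σs ++ Γ) τs → Terms✶ Γ (σs ⇛ τs)
ƛᵃ σs ts = map⁺ (All.map (ƛ* σs) ts)

⟦ƛᵃ⟧ : ∀ σs (ts : Terms✶ (σs ++ Γ) τs) (γ : Env Γ) (xs : Env σs) →
       applyAll σs τs (⟦ ƛᵃ σs ts ⟧* γ) xs ≡ ⟦ ts ⟧* (append σs Γ xs γ)
⟦ƛᵃ⟧ σs []       γ xs = refl
⟦ƛᵃ⟧ σs (t ∷ ts) γ xs = cong₂ _,_ (⟦ƛ*⟧ σs t γ xs) (⟦ƛᵃ⟧ σs ts γ xs)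

-- Finite sets

Mem : ∀ σs → Env σs → Env (σs ✶*) → Set
Mem []       _        _        = ⊤
Mem (σ ∷ σs) (x , xs) (X , Xs) = _∈ˢ_ {σ} x X × Mem σs xs Xs

infix 4 Mem
syntax Mem σs xs Xs = xs ∈[ σs ] Xs

nonempty : ∀ σs (Xs : Env (σs ✶*)) → ∃ λ xs → xs ∈[ σs ] Xs
nonempty []       _        = tt , tt
nonempty (σ ∷ σs) (X , Xs) =
  let xs , p = nonempty σs Xs in (head X , xs) , here (Setoid.refl ⟦ σ ⟧) , p

∈-singleton : (x : El σ) → _∈ˢ_ {σ} x (⟦ singleton {σ} ⟧ᶜ✶ ⟨$⟩ x)
∈-singleton {σ} x = here (Setoid.refl ⟦ σ ⟧)

∈-unionˡ : (x : El σ) (X Y : El (σ ✶)) → _∈ˢ_ {σ} x X →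
           _∈ˢ_ {σ} x (⟦ union {σ} ⟧ᶜ✶ ⟨$⟩ X ⟨$⟩ Y)
∈-unionˡ {σ} x X Y p = Membershipₚ.∈-++⁺ˡ ⟦ σ ⟧ p

∈-unionʳ : (x : El σ) (X Y : El (σ ✶)) → _∈ˢ_ {σ} x Y →
           _∈ˢ_ {σ} x (⟦ union {σ} ⟧ᶜ✶ ⟨$⟩ X ⟨$⟩ Y)
∈-unionʳ {σ} x X Y p = Membershipₚ.∈-++⁺ʳ ⟦ σ ⟧ (toList X) p

∈-⋃ : (x : El σ) (y : El τ) (X : El (σ ✶)) (f : El (σ ⇒ τ ✶)) →
      _∈ˢ_ {σ} x X → _∈ˢ_ {τ} y (f ⟨$⟩ x) → _∈ˢ_ {τ} y (⟦ ⋃ {σ} {τ} ⟧ᶜ✶ ⟨$⟩ X ⟨$⟩ f)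
∈-⋃ {σ} {τ} x y X f p q =
  Anyₚ.concat⁺ (Anyₚ.map⁺ {f = toList} (Anyₚ.map⁺ {f = f ⟨$⟩_}
    (Any.map (λ x≈z → proj₁ (Func.cong f x≈z) q) p)))

singletons : Terms✶ Γ σs → Terms✶ Γ (σs ✶*)
singletons ts = map⁺ (All.map (con singleton ·_) ts)

∈-singletons : (ts : Terms✶ Γ σs) (γ : Env Γ) → ⟦ ts ⟧* γ ∈[ σs ] ⟦ singletons ts ⟧* γ
∈-singletons []             γ = tt
∈-singletons {σs = σ ∷ _} (t ∷ ts) γ = ∈-singleton {σ} (⟦ t ⟧ᵗ γ) , ∈-singletons ts γ

unions : ∀ σs → Terms✶ Γ (σs ✶*) → Terms✶ Γ (σs ✶*) → Terms✶ Γ (σs ✶*)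
unions []       []       []       = []
unions (_ ∷ σs) (X ∷ Xs) (Y ∷ Ys) = con union · X · Y ∷ unions σs Xs Ys

∈-unionsˡ : ∀ σs (Xs Ys : Terms✶ Γ (σs ✶*)) (γ : Env Γ) {xs} →
            xs ∈[ σs ] ⟦ Xs ⟧* γ → xs ∈[ σs ] ⟦ unions σs Xs Ys ⟧* γ
∈-unionsˡ []       []       []       γ _       = tt
∈-unionsˡ (σ ∷ σs) (X ∷ Xs) (Y ∷ Ys) γ {x , _} (p , q) =
  ∈-unionˡ {σ} x (⟦ X ⟧ᵗ γ) (⟦ Y ⟧ᵗ γ) p , ∈-unionsˡ σs Xs Ys γ q

∈-unionsʳ : ∀ σs (Xs Ys : Terms✶ Γ (σs ✶*)) (γ : Env Γ) {xs} →
            xs ∈[ σs ] ⟦ Ys ⟧* γ → xs ∈[ σs ] ⟦ unions σs Xs Ys ⟧* γ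
∈-unionsʳ []       []       []       γ _       = tt
∈-unionsʳ (σ ∷ σs) (X ∷ Xs) (Y ∷ Ys) γ {x , _} (p , q) =
  ∈-unionʳ {σ} x (⟦ X ⟧ᵗ γ) (⟦ Y ⟧ᵗ γ) p , ∈-unionsʳ σs Xs Ys γ q

-- The head of the tuple becomes the innermost union, so its set is weakened past the variables of
-- the outer ones.
bigUnion : ∀ σs → Terms✶ Γ (σs ✶*) → Term✶ (σs ++ Γ) (τ ✶) → Term✶ Γ (τ ✶)
bigUnion []       []       t = t
bigUnion (_ ∷ σs) (X ∷ Xs) t = bigUnion σs Xs (con ⋃ · wk σs X · ƛ t)

∈-bigUnion : ∀ {Γ τ} σs (Xs : Terms✶ Γ (σs ✶*)) (t : Term✶ (σs ++ Γ) (τ ✶)) (γ : Env Γ) {xs y} →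
             xs ∈[ σs ] ⟦ Xs ⟧* γ → _∈ˢ_ {τ} y (⟦ t ⟧ᵗ (append σs Γ xs γ)) →
             _∈ˢ_ {τ} y (⟦ bigUnion σs Xs t ⟧ᵗ γ)
∈-bigUnion         []       []       t γ _       q = q
∈-bigUnion {Γ} {τ} (σ ∷ σs) (X ∷ Xs) t γ {x , xs} {y} (p , ps) q =
  ∈-bigUnion σs Xs (con ⋃ · wk σs X · ƛ t) γ ps
    (∈-⋃ {σ} {τ} x y (⟦ wk σs X ⟧ᵗ δ) (⟦ ƛ t ⟧ᵗ δ)
      (subst (_∈ˢ_ {σ} x) (sym (trans (⟦wk⟧ σs X δ) (cong ⟦ X ⟧ᵗ (drop-append σs Γ xs γ)))) p)
      (subst (_∈ˢ_ {τ} y) (sym (⟦ƛ⟧ t δ x)) q))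
  where δ = append σs Γ xs γ

bigUnions : ∀ σs τs → Terms✶ Γ (σs ✶*) → Terms✶ (σs ++ Γ) (τs ✶*) → Terms✶ Γ (τs ✶*)
bigUnions σs []       Xs []       = []
bigUnions σs (_ ∷ τs) Xs (t ∷ ts) = bigUnion σs Xs t ∷ bigUnions σs τs Xs ts

-- A tuple of sets stands for their product, and each component is united separately. The result may
-- therefore contain mixed tuples, which come from no single index; this inclusion is the direction
-- that soundness of challenges uses.
∈-bigUnions : ∀ {Γ} σs τs (Xs : Terms✶ Γ (σs ✶*)) (ts : Terms✶ (σs ++ Γ) (τs ✶*))
              (γ : Env Γ) {xs ys} → xs ∈[ σs ] ⟦ Xs ⟧* γ →
              ys ∈[ τs ] ⟦ ts ⟧* (append σs Γ xs γ) → ys ∈[ τs ] ⟦ bigUnions σs τs Xs ts ⟧* γ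
∈-bigUnions σs []       Xs []       γ p _       = tt
∈-bigUnions σs (τ ∷ τs) Xs (t ∷ ts) γ p (q , qs) =
  ∈-bigUnion σs Xs t γ p q , ∈-bigUnions σs τs Xs ts γ p qs

split✶ : ∀ σs → Terms✶ Γ ((σs ++ τs) ✶*) → Terms✶ Γ (σs ✶*) × Terms✶ Γ (τs ✶*)
split✶ []       Xs       = [] , Xs
split✶ (_ ∷ σs) (X ∷ Xs) = let Ys , Zs = split✶ σs Xs in X ∷ Ys , Zs

∈-split✶ : ∀ σs τs (Xs : Terms✶ Γ ((σs ++ τs) ✶*)) (γ : Env Γ) {xs} →
           xs ∈[ σs ++ τs ] ⟦ Xs ⟧* γ →
           take σs τs xs ∈[ σs ] ⟦ proj₁ (split✶ σs Xs) ⟧* γ ×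
           drop σs τs xs ∈[ τs ] ⟦ proj₂ (split✶ σs Xs) ⟧* γ
∈-split✶ []       τs Xs       γ p        = tt , p
∈-split✶ (_ ∷ σs) τs (X ∷ Xs) γ (p , ps) =
  let q , r = ∈-split✶ σs τs Xs γ ps in (p , q) , r

append✶ : ∀ σs → Terms✶ Γ (σs ✶*) → Terms✶ Γ (τs ✶*) → Terms✶ Γ ((σs ++ τs) ✶*)
append✶ []       []       Ys = Ys
append✶ (_ ∷ σs) (X ∷ Xs) Ys = X ∷ append✶ σs Xs Ys

∈-append✶ : ∀ σs τs (Xs : Terms✶ Γ (σs ✶*)) (Ys : Terms✶ Γ (τs ✶*)) (γ : Env Γ) {xs ys} →
            xs ∈[ σs ] ⟦ Xs ⟧* γ → ys ∈[ τs ] ⟦ Ys ⟧* γ →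
            append σs τs xs ys ∈[ σs ++ τs ] ⟦ append✶ {τs = τs} σs Xs Ys ⟧* γ
∈-append✶ []       τs []       Ys γ _        q = q
∈-append✶ (_ ∷ σs) τs (X ∷ Xs) Ys γ (p , ps) q = p , ∈-append✶ σs τs Xs Ys γ ps q

-- Sets of challenges cannot be empty, so a premise with nothing to be asked is still challenged at
-- some element.
default : ∀ σ → Term✶ Γ σ
default N       = con (base O)
default B       = con (base O₂)
default (σ ⇒ τ) = con (base (Π tt tt)) · default τ
default (σ ✶)   = con singleton · default σ

defaults : ∀ σs → Terms✶ Γ σs
defaults σs = All.tabulate (λ {σ} _ → default σ)

-- The order of positive witnesses

-- Positive witnesses never have type B, hence the trivial order there.
Below : ∀ σ → El σ → El σ → Set
Below N       k n = k ≤ n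
Below B       i j = ⊤
Below (σ ⇒ τ) f g = ∀ x → Below τ (f ⟨$⟩ x) (g ⟨$⟩ x)
Below (σ ✶)   X Y = ∀ x → _∈ˢ_ {σ} x X → _∈ˢ_ {σ} x Y

infix 4 Below
syntax Below σ x y = x ≼[ σ ] y

Below* : ∀ σs → Env σs → Env σs → Set
Below* []       _        _        = ⊤
Below* (σ ∷ σs) (x , xs) (y , ys) = x ≼[ σ ] y × Below* σs xs ys

infix 4 Below*
syntax Below* σs xs ys = xs ≼*[ σs ] ys

≼-refl : ∀ σ (x : El σ) → x ≼[ σ ] x
≼-refl N       n = ℕₚ.≤-refl
≼-refl B       i = tt
≼-refl (σ ⇒ τ) f = λ x → ≼-refl τ (f ⟨$⟩ x)
≼-refl (σ ✶)   X = λ _ → id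

≼-trans : ∀ σ (x y z : El σ) → x ≼[ σ ] y → y ≼[ σ ] z → x ≼[ σ ] z
≼-trans N       k l n p q = ℕₚ.≤-trans p q
≼-trans B       i j k p q = tt
≼-trans (σ ⇒ τ) f g h p q = λ x → ≼-trans τ (f ⟨$⟩ x) (g ⟨$⟩ x) (h ⟨$⟩ x) (p x) (q x)
≼-trans (σ ✶)   X Y Z p q = λ x → q x ∘ p x

≼*-refl : ∀ σs (xs : Env σs) → xs ≼*[ σs ] xs
≼*-refl []       _        = tt
≼*-refl (σ ∷ σs) (x , xs) = ≼-refl σ x , ≼*-refl σs xs

≼*-trans : ∀ σs (xs ys zs : Env σs) → xs ≼*[ σs ] ys → ys ≼*[ σs ] zs → xs ≼*[ σs ] zs
≼*-trans []       _        _        _        _        _        = tt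
≼*-trans (σ ∷ σs) (x , xs) (y , ys) (z , zs) (p , ps) (q , qs) =
  ≼-trans σ x y z p q , ≼*-trans σs xs ys zs ps qs

≼*-take : ∀ σs τs {xs ys : Env (σs ++ τs)} → xs ≼*[ σs ++ τs ] ys →
          take σs τs xs ≼*[ σs ] take σs τs ys
≼*-take []       τs _        = tt
≼*-take (_ ∷ σs) τs (p , ps) = p , ≼*-take σs τs ps

≼*-drop : ∀ σs τs {xs ys : Env (σs ++ τs)} → xs ≼*[ σs ++ τs ] ys →
          drop σs τs xs ≼*[ τs ] drop σs τs ys
≼*-drop []       τs p        = p
≼*-drop (_ ∷ σs) τs (_ , ps) = ≼*-drop σs τs ps

≼-apply : ∀ σs τ {f g : El (σs ⇒* τ)} (xs : Env σs) → f ≼[ σs ⇒* τ ] g →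
          apply σs f xs ≼[ τ ] apply σs g xs
≼-apply []       τ _        p = p
≼-apply (_ ∷ σs) τ (x , xs) p = ≼-apply σs τ xs (p x)

≼*-applyAll : ∀ σs τs {fs gs : Env (σs ⇛ τs)} (xs : Env σs) → fs ≼*[ σs ⇛ τs ] gs →
              applyAll σs τs fs xs ≼*[ τs ] applyAll σs τs gs xs
≼*-applyAll σs []       xs _        = tt
≼*-applyAll σs (τ ∷ τs) xs (p , ps) = ≼-apply σs τ xs p , ≼*-applyAll σs τs xs ps

∈-≼* : ∀ σs {xs : Env σs} {Xs Ys : Env (σs ✶*)} → Xs ≼*[ σs ✶* ] Ys →
       xs ∈[ σs ] Xs → xs ∈[ σs ] Ys
∈-≼* []       _        _        = tt
∈-≼* (σ ∷ σs) (p , ps) (q , qs) = p _ q , ∈-≼* σs ps qs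

join : ∀ σ → Term✶ Γ σ → Term✶ Γ σ → Term✶ Γ σ
join N       t u = con m · (con union · (con singleton · t) · (con singleton · u))
join B       t u = t
join (σ ⇒ τ) t u = ƛ (join τ (wk (σ ∷ []) t · v₀) (wk (σ ∷ []) u · v₀))
join (σ ✶)   t u = con union · t · u

join-upperˡ : ∀ σ (t u : Term✶ Γ σ) (γ : Env Γ) → ⟦ t ⟧ᵗ γ ≼[ σ ] ⟦ join σ t u ⟧ᵗ γ
join-upperˡ N       t u γ =
  All.lookup (xs≤max 0 (⟦ t ⟧ᵗ γ ∷ ⟦ u ⟧ᵗ γ ∷ [])) (here refl)
join-upperˡ B       t u γ = tt
join-upperˡ (σ ⇒ τ) t u γ x =
  subst₂ (Below τ) (cong (_⟨$⟩ x) (⟦wk⟧ (σ ∷ []) t (x , γ))) (sym (⟦ƛ⟧ (join τ _ _) γ x))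
    (join-upperˡ τ (wk (σ ∷ []) t · v₀) (wk (σ ∷ []) u · v₀) (x , γ))
join-upperˡ (σ ✶)   t u γ x p = ∈-unionˡ {σ} x (⟦ t ⟧ᵗ γ) (⟦ u ⟧ᵗ γ) p

join-upperʳ : ∀ σ (t u : Term✶ Γ σ) (γ : Env Γ) → ⟦ u ⟧ᵗ γ ≼[ σ ] ⟦ join σ t u ⟧ᵗ γ
join-upperʳ N       t u γ =
  All.lookup (xs≤max 0 (⟦ t ⟧ᵗ γ ∷ ⟦ u ⟧ᵗ γ ∷ [])) (there (here refl))
join-upperʳ B       t u γ = tt
join-upperʳ (σ ⇒ τ) t u γ x =
  subst₂ (Below τ) (cong (_⟨$⟩ x) (⟦wk⟧ (σ ∷ []) u (x , γ))) (sym (⟦ƛ⟧ (join τ _ _) γ x))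
    (join-upperʳ τ (wk (σ ∷ []) t · v₀) (wk (σ ∷ []) u · v₀) (x , γ))
join-upperʳ (σ ✶)   t u γ x p = ∈-unionʳ {σ} x (⟦ t ⟧ᵗ γ) (⟦ u ⟧ᵗ γ) p

joins : ∀ σs → Terms✶ Γ σs → Terms✶ Γ σs → Terms✶ Γ σs
joins []       []       []       = []
joins (σ ∷ σs) (t ∷ ts) (u ∷ us) = join σ t u ∷ joins σs ts us

joins-upperˡ : ∀ σs (ts us : Terms✶ Γ σs) (γ : Env Γ) → ⟦ ts ⟧* γ ≼*[ σs ] ⟦ joins σs ts us ⟧* γ
joins-upperˡ []       []       []       γ = tt
joins-upperˡ (σ ∷ σs) (t ∷ ts) (u ∷ us) γ = join-upperˡ σ t u γ , joins-upperˡ σs ts us γ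

joins-upperʳ : ∀ σs (ts us : Terms✶ Γ σs) (γ : Env Γ) → ⟦ us ⟧* γ ≼*[ σs ] ⟦ joins σs ts us ⟧* γ
joins-upperʳ []       []       []       γ = tt
joins-upperʳ (σ ∷ σs) (t ∷ ts) (u ∷ us) γ = join-upperʳ σ t u γ , joins-upperʳ σs ts us γ

-- Iteration

apply-curry* : ∀ {X : Setoid _ _} σs (f : Func (_) ⟦ τ ⟧) (x : Setoid.Carrier X) (ys : Env σs) →
               apply σs (curry* {τ = τ} {X = X} σs f ⟨$⟩ x) ys ≡ f ⟨$⟩ (x , ys)
apply-curry* []       f x _        = refl
apply-curry* (_ ∷ σs) f x (y , ys) = apply-curry* σs _ (x , y) ys

apply-R : ∀ {P} σs (hs : All P σs) (i : τ ∈ˡ σs) n ws fs →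
          apply (steps σs) (apply σs (⟦ R hs i ⟧ᶜ ⟨$⟩ n) ws) fs ≡ lookup i (recurse σs n ws fs)
apply-R {τ} σs hs i n ws fs =
  trans (cong (λ f → apply (steps σs) f fs) (apply-curry* σs _ n ws))
    (apply-curry* {τ = τ} (steps σs) _ (n , ws) fs)

-- Iteration is recursion with a step that ignores the stage number; the leading Π discards it.
stepTerms : ∀ σs → Terms✶ (σs ++ Γ) τs → Terms✶ Γ (map (λ τ → N ⇒ σs ⇒* τ) τs)
stepTerms σs ts = map⁺ (All.map (λ t → con (base (Π tt tt)) · ƛ* σs t) ts)

stepAll-stepTerms : ∀ {Γ} σs τs (ts : Terms✶ (σs ++ Γ) τs) (γ : Env Γ) n xs →
                    stepAll σs τs (⟦ stepTerms σs ts ⟧* γ) n xs ≡ ⟦ ts ⟧* (append σs Γ xs γ)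
stepAll-stepTerms σs []       []       γ n xs = refl
stepAll-stepTerms σs (_ ∷ τs) (t ∷ ts) γ n xs =
  cong₂ _,_ (⟦ƛ*⟧ σs t γ xs) (stepAll-stepTerms σs τs ts γ n xs)

iterate : ∀ σs → Terms✶ Γ σs → Terms✶ (σs ++ Γ) σs → Env Γ → ℕ → Env σs
iterate     σs ws ts γ zero    = ⟦ ws ⟧* γ
iterate {Γ} σs ws ts γ (suc n) = ⟦ ts ⟧* (append σs Γ (iterate σs ws ts γ n) γ)

iterateTerm : ∀ σs → Terms✶ Γ σs → Terms✶ (σs ++ Γ) σs → Term✶ Γ N → Terms✶ Γ σs
iterateTerm σs ws ts n = All.tabulate λ i →
  (_·*_ {σs = σs} (con (base (R (All.tabulate (λ _ → tt)) i)) · n) ws) ·* stepTerms σs ts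

⟦iterateTerm⟧ : ∀ σs (ws : Terms✶ Γ σs) (ts : Terms✶ (σs ++ Γ) σs) (n : Term✶ Γ N) (γ : Env Γ) →
                ⟦ iterateTerm σs ws ts n ⟧* γ ≡ iterate σs ws ts γ (⟦ n ⟧ᵗ γ)
⟦iterateTerm⟧ σs ws ts n γ = trans
  (⟦tabulate⟧ _ γ (recurse σs (⟦ n ⟧ᵗ γ) (⟦ ws ⟧* γ) (⟦ stepTerms σs ts ⟧* γ)) λ i →
    trans (⟦·*⟧ (_ ·* ws) (stepTerms σs ts) γ)
      (trans (cong (λ f → apply (steps σs) f (⟦ stepTerms σs ts ⟧* γ)) (⟦·*⟧ (_ · n) ws γ))
        (apply-R σs (All.tabulate (λ _ → tt)) i (⟦ n ⟧ᵗ γ) (⟦ ws ⟧* γ) (⟦ stepTerms σs ts ⟧* γ))))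
  (recurse-stepTerms (⟦ n ⟧ᵗ γ))
  where
  recurse-stepTerms : ∀ n → recurse σs n (⟦ ws ⟧* γ) (⟦ stepTerms σs ts ⟧* γ) ≡ iterate σs ws ts γ n
  recurse-stepTerms zero    = refl
  recurse-stepTerms (suc n) =
    trans (stepAll-stepTerms σs σs ts γ n _)
      (cong (λ xs → ⟦ ts ⟧* (append σs _ xs γ)) (recurse-stepTerms n))

-- Predicates with witnesses

-- `X` collects the values of the free variables. As an arbitrary set it allows `reindex` to play
-- the role of substitution, weakening and permutation of variables at once.
record Pred (X : Set) (W : WitnessTypes) : Set₁ where
  constructor pred
  field holds : X → Env (pos W) → Env (neg W) → Set

open Pred

variable
  X Y   : Set
  U V W : WitnessTypes

reindex : (Y → X) → Pred X W → Pred Y W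
reindex f P = pred λ y → holds P (f y)

infixr 6 _∧ₚ_
infixr 5 _⊃ₚ_

_∧ₚ_ : Pred X V → Pred X W → Pred X (V ∧ᵂ W)
_∧ₚ_ {V = V} {W = W} P Q = pred λ x ac bd →
  holds P x (take (pos V) (pos W) ac) (take (neg V) (neg W) bd) ×
  holds Q x (drop (pos V) (pos W) ac) (drop (neg V) (neg W) bd)

implies : Pred X V → Pred X W → X → Env (pos V ⇛ pos W) → Env (pos V ⇛ neg W ⇛ neg V ✶*) →
          Env (pos V) → Env (neg W) → Set
implies {V = V} {W = W} P Q x f g a d =
  (∀ b → b ∈[ neg V ] applyAll (neg W) (neg V ✶*) (applyAll (pos V) (neg W ⇛ neg V ✶*) g a) d →
         holds P x a b) →
  holds Q x (applyAll (pos V) (pos W) f a) d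

_⊃ₚ_ : Pred X V → Pred X W → Pred X (V ⊃ᵂ W)
_⊃ₚ_ {V = V} {W = W} P Q = pred λ x fg ad →
  implies P Q x (take (pos V ⇛ pos W) (pos V ⇛ neg W ⇛ neg V ✶*) fg)
                (drop (pos V ⇛ pos W) (pos V ⇛ neg W ⇛ neg V ✶*) fg)
                (take (pos V) (neg W) ad) (drop (pos V) (neg W) ad)

⊤ₚ : Pred X noneᵂ
⊤ₚ = pred λ _ _ _ → ⊤

allₚ : Pred (Y × X) W → Pred X W
allₚ P = pred λ x a b → ∀ y → holds P (y , x) a b

exₚ : Pred (Y × X) W → Pred X (exᵂ W)
exₚ {W = W} P = pred λ x a bs → ∃ λ y → ∀ b → b ∈[ neg W ] bs → holds P (y , x) a b

-- Unlike `_∧ₚ_`, which concatenates witnesses, this demands that one and the same witness serve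
-- both sides. It prepares a case distinction whose outcome the terms cannot see.
meetₚ : Pred X W → Pred X W → Pred X W
meetₚ P Q = pred λ x a b → holds P x a b × holds Q x a b

Mono : Pred X W → Set _
Mono {W = W} P = ∀ x {a a′} b → a ≼*[ pos W ] a′ → holds P x a b → holds P x a′ b

∧ₚ-mono : {P : Pred X V} {Q : Pred X W} → Mono P → Mono Q → Mono (P ∧ₚ Q)
∧ₚ-mono {V = V} {W = W} mP mQ x b p (q , r) =
  mP x _ (≼*-take (pos V) (pos W) p) q , mQ x _ (≼*-drop (pos V) (pos W) p) r

-- The witness `a` of `P` is fixed. A larger `f` yields a larger witness of `Q`, where `mQ` applies;
-- a larger `g` asks for more challenges to `P` and so makes the premise stronger.
⊃ₚ-mono : {P : Pred X V} {Q : Pred X W} → Mono Q → Mono (P ⊃ₚ Q)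
⊃ₚ-mono {V = V} {W = W} mQ x ad p q r =
  let a = take (pos V) (neg W) ad
      d = drop (pos V) (neg W) ad
  in mQ x d (≼*-applyAll (pos V) (pos W) a (≼*-take (pos V ⇛ pos W) (pos V ⇛ neg W ⇛ neg V ✶*) p))
       (q λ b b∈ → r b (∈-≼* (neg V)
         (≼*-applyAll (neg W) (neg V ✶*) d (≼*-applyAll (pos V) (neg W ⇛ neg V ✶*) a
           (≼*-drop (pos V ⇛ pos W) (pos V ⇛ neg W ⇛ neg V ✶*) p))) b∈))

-- Entailment

infix 4 _⊢_

record _⊢_ {X V W} (P : Pred X V) (Q : Pred X W) : Set where
  constructor entails
  field
    witness   : Terms✶ (pos V) (pos W)
    challenge : Terms✶ (pos V ++ neg W) (neg V ✶*)
    sound     : ∀ x a d →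
                (∀ b → b ∈[ neg V ] ⟦ challenge ⟧* (append (pos V) (neg W) a d) → holds P x a b) →
                holds Q x (⟦ witness ⟧* a) d

open _⊢_

⟦new⟧ : ∀ σs Γ xs γ → ⟦ newˢ {Γ = Γ} σs ⟧* (append σs Γ xs γ) ≡ xs
⟦new⟧ σs Γ xs γ = trans (⟦newˢ⟧ σs Γ _) (take-append σs Γ xs γ)

⟦old⟧ : ∀ σs Γ xs γ → ⟦ oldˢ {Γ = Γ} σs ⟧* (append σs Γ xs γ) ≡ γ
⟦old⟧ σs Γ xs γ = trans (⟦oldˢ⟧ σs Γ _) (drop-append σs Γ xs γ)

⟦weaken⟧ : ∀ σs (ts : Terms✶ Γ τs) xs γ → ⟦ wk* σs ts ⟧* (append σs Γ xs γ) ≡ ⟦ ts ⟧* γ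
⟦weaken⟧ {Γ} σs ts xs γ = trans (⟦wk⟧* σs ts _) (cong ⟦ ts ⟧* (drop-append σs Γ xs γ))

⟦append⟧ : (s : Terms✶ Γ σs) (t : Terms✶ Γ τs) (γ : Env Γ) {xs : Env σs} {ys : Env τs} →
           ⟦ s ⟧* γ ≡ xs → ⟦ t ⟧* γ ≡ ys → ⟦ ++⁺ s t ⟧* γ ≡ append σs τs xs ys
⟦append⟧ s t γ refl refl = ⟦++⁺⟧ s t γ

⟦inst⟧ : (ts : Terms✶ Γ τs) (s : Terms✶ Δ Γ) (γ : Env Δ) {xs : Env Γ} →
         ⟦ s ⟧* γ ≡ xs → ⟦ ts [ s ]* ⟧* γ ≡ ⟦ ts ⟧* xs
⟦inst⟧ ts s γ refl = ⟦sub⟧* ts s γ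

⟦··⟧-≡ : ∀ σs τs (ts : Terms✶ Γ (σs ⇛ τs)) (us : Terms✶ Γ σs) (γ : Env Γ) {fs xs} →
         ⟦ ts ⟧* γ ≡ fs → ⟦ us ⟧* γ ≡ xs →
         ⟦ _··_ {σs = σs} {τs = τs} ts us ⟧* γ ≡ applyAll σs τs fs xs
⟦··⟧-≡ σs τs ts us γ refl refl = ⟦··⟧ τs ts us γ

∈-singletons-≡ : (ts : Terms✶ Γ σs) (γ : Env Γ) {xs : Env σs} →
                 ⟦ ts ⟧* γ ≡ xs → xs ∈[ σs ] ⟦ singletons ts ⟧* γ
∈-singletons-≡ ts γ refl = ∈-singletons ts γ

∈-≡ : ∀ {σs} {xs : Env σs} {Xs Ys : Env (σs ✶*)} → Xs ≡ Ys → xs ∈[ σs ] Ys → xs ∈[ σs ] Xs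
∈-≡ refl p = p

-- The witness is passed on and the challenge is handed back as a singleton, so facts about the
-- structure can be used without any computation on witnesses.
⊢-pointwise : {P Q : Pred X W} → (∀ x a b → holds P x a b → holds Q x a b) → P ⊢ Q
⊢-pointwise {W = W} {Q = Q} h = record
  { witness   = idˢ
  ; challenge = singletons (oldˢ (pos W))
  ; sound     = λ x a d hyp → subst (λ a → holds Q x a d) (sym (⟦idˢ⟧ (pos W) a))
      (h x a d (hyp d (∈-singletons-≡ (oldˢ (pos W)) _ (⟦old⟧ (pos W) (neg W) a d))))
  }

⊢-refl : {P : Pred X W} → P ⊢ P
⊢-refl = ⊢-pointwise λ _ _ _ → id

⊢-reindex : {P : Pred X V} {Q : Pred X W} (h : Y → X) → P ⊢ Q → reindex h P ⊢ reindex h Q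
⊢-reindex h p = record { witness = witness p ; challenge = challenge p ; sound = sound p ∘ h }

-- Challenges travel backwards: `d` leads to a set of challenges to `Q`, each of these to a set of
-- challenges to `P`, and the indexed union collects the latter.
⊢-trans : {P : Pred X U} {Q : Pred X V} {K : Pred X W} → P ⊢ Q → Q ⊢ K → P ⊢ K
⊢-trans {U = U} {V = V} {W = W} {K = K} p q = record
  { witness   = witness q [ witness p ]*
  ; challenge = bigUnions (neg V) (neg U) inner outer
  ; sound     = λ x a d hyp → subst (λ c → holds K x c d) (sym (⟦sub⟧* (witness q) (witness p) a))
      (sound q x (⟦ witness p ⟧* a) d λ c c∈ → sound p x a c λ b b∈ → hyp b
        (∈-bigUnions (neg V) (neg U) inner outer (append (pos U) (neg W) a d)
          (∈-≡ (⟦inst⟧ (challenge q) _ _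
            (⟦append⟧ (witness p [ as ]*) ds _
              (⟦inst⟧ (witness p) as _ (⟦new⟧ (pos U) (neg W) a d)) (⟦old⟧ (pos U) (neg W) a d))) c∈)
          (∈-≡ (⟦inst⟧ (challenge p) _ _
            (⟦append⟧ (wk* (neg V) as) (newˢ (neg V)) _
              (trans (⟦weaken⟧ (neg V) as c _) (⟦new⟧ (pos U) (neg W) a d))
              (⟦new⟧ (neg V) (pos U ++ neg W) c _))) b∈)))
  }
  where
  as = newˢ {Γ = neg W} (pos U)
  ds = oldˢ {Γ = neg W} (pos U)
  inner = challenge q [ ++⁺ (witness p [ as ]*) ds ]*
  outer = challenge p [ ++⁺ (wk* (neg V) as) (newˢ (neg V)) ]*

-- This rule contains contraction, as `P` serves both conclusions. The union of the two sets of
-- challenges does the work for which the Dialectica interpretation decides which of two challenges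
-- fails.
∧-intro : {P : Pred X U} {Q : Pred X V} {K : Pred X W} → P ⊢ Q → P ⊢ K → P ⊢ Q ∧ₚ K
∧-intro {U = U} {V = V} {W = W} {Q = Q} {K = K} p q = record
  { witness   = ++⁺ (witness p) (witness q)
  ; challenge = unions (neg U) left right
  ; sound     = λ x a d hyp →
      let γ  = append (pos U) (neg V ++ neg W) a d
          d₁ = take (neg V) (neg W) d
          d₂ = drop (neg V) (neg W) d
          eq = ⟦++⁺⟧ (witness p) (witness q) a
      in subst (λ c → holds Q x c d₁)
           (sym (trans (cong (take (pos V) (pos W)) eq) (take-append (pos V) (pos W) _ _)))
           (sound p x a d₁ λ b b∈ → hyp b (∈-unionsˡ (neg U) left right γ
             (∈-≡ (⟦inst⟧ (challenge p) _ γ (⟦append⟧ as _ γ (⟦new⟧ (pos U) _ a d)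
               (trans (⟦weaken⟧ (pos U) (newˢ (neg V)) a d) (⟦newˢ⟧ (neg V) (neg W) d)))) b∈)))
         , subst (λ c → holds K x c d₂)
           (sym (trans (cong (drop (pos V) (pos W)) eq) (drop-append (pos V) (pos W) _ _)))
           (sound q x a d₂ λ b b∈ → hyp b (∈-unionsʳ (neg U) left right γ
             (∈-≡ (⟦inst⟧ (challenge q) _ γ (⟦append⟧ as _ γ (⟦new⟧ (pos U) _ a d)
               (trans (⟦weaken⟧ (pos U) (oldˢ (neg V)) a d) (⟦oldˢ⟧ (neg V) (neg W) d)))) b∈)))
  }
  where
  as = newˢ {Γ = neg V ++ neg W} (pos U)
  left  = challenge p [ ++⁺ as (wk* (pos U) (newˢ (neg V))) ]*
  right = challenge q [ ++⁺ as (wk* (pos U) (oldˢ (neg V))) ]*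

-- A challenge to P is answered only along with one to Q, so every set of
-- challenges to Q must be inhabited.
∧-elimˡ : {P : Pred X V} {Q : Pred X W} → P ∧ₚ Q ⊢ P
∧-elimˡ {V = V} {W = W} {P = P} = record
  { witness   = newˢ (pos V)
  ; challenge = append✶ (neg V) (singletons ds) (defaults (neg W ✶*))
  ; sound     = λ x a d hyp →
      let γ = append (pos V ++ pos W) (neg V) a d
          e , e∈ = nonempty (neg W) (⟦ defaults (neg W ✶*) ⟧* γ)
          p , _ = hyp (append (neg V) (neg W) d e)
            (∈-append✶ (neg V) (neg W) (singletons ds) (defaults (neg W ✶*)) γ
              (∈-singletons-≡ ds γ (⟦old⟧ (pos V ++ pos W) (neg V) a d)) e∈)
      in subst₂ (holds P x) (sym (⟦newˢ⟧ (pos V) (pos W) a)) (take-append (neg V) (neg W) d e) p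
  }
  where ds = oldˢ {Γ = neg V} (pos V ++ pos W)

∧-elimʳ : {P : Pred X V} {Q : Pred X W} → P ∧ₚ Q ⊢ Q
∧-elimʳ {V = V} {W = W} {Q = Q} = record
  { witness   = oldˢ (pos V)
  ; challenge = append✶ (neg V) (defaults (neg V ✶*)) (singletons ds)
  ; sound     = λ x a d hyp →
      let γ = append (pos V ++ pos W) (neg W) a d
          e , e∈ = nonempty (neg V) (⟦ defaults (neg V ✶*) ⟧* γ)
          _ , q = hyp (append (neg V) (neg W) e d)
            (∈-append✶ (neg V) (neg W) (defaults (neg V ✶*)) (singletons ds) γ
              e∈ (∈-singletons-≡ ds γ (⟦old⟧ (pos V ++ pos W) (neg W) a d)))
      in subst₂ (holds Q x) (sym (⟦oldˢ⟧ (pos V) (pos W) a)) (drop-append (neg V) (neg W) e d) q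
  }
  where ds = oldˢ {Γ = neg W} (pos V ++ pos W)

-- The challenges of `p` to the conjunction split in two. The part for `P` remains a challenge of
-- the new entailment; the part for `Q`, abstracted over the witness of `Q` and the challenge to
-- `K`, becomes the negative functional of the implication. Thus `inner` and `outer` are the same
-- tuple in two contexts.
⊃-intro : {P : Pred X U} {Q : Pred X V} {K : Pred X W} → P ∧ₚ Q ⊢ K → P ⊢ Q ⊃ₚ K
⊃-intro {U = U} {V = V} {W = W} {P = P} {Q = Q} {K = K} p = record
  { witness   = ++⁺ F G
  ; challenge = proj₁ (split✶ (neg U) outer)
  ; sound     = λ x a cd hyp hypQ →
      let c  = take (pos V) (neg W) cd
          d  = drop (pos V) (neg W) cd
          γ  = append (pos U) (pos V ++ neg W) a cd
          ca = append (pos V) (pos U) c a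
          δ  = append (neg W) (pos V ++ pos U) d ca
          eq = ⟦++⁺⟧ F G a
          eqF : applyAll (pos V) (pos W) (take (pos V ⇛ pos W) _ (⟦ ++⁺ F G ⟧* a)) c
                ≡ ⟦ witness p ⟧* (append (pos U) (pos V) a c)
          eqF = trans (cong (λ h → applyAll (pos V) (pos W) h c)
                  (trans (cong (take (pos V ⇛ pos W) _) eq) (take-append (pos V ⇛ pos W) _ _ _)))
                (trans (⟦ƛᵃ⟧ (pos V) _ a c)
                  (⟦inst⟧ (witness p) _ ca (⟦append⟧ (oldˢ (pos V)) (newˢ (pos V)) ca
                    (⟦old⟧ (pos V) (pos U) c a) (⟦new⟧ (pos V) (pos U) c a))))
          eqG : applyAll (neg W) (neg V ✶*) (applyAll (pos V) (neg W ⇛ neg V ✶*)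
                  (drop (pos V ⇛ pos W) _ (⟦ ++⁺ F G ⟧* a)) c) d
                ≡ ⟦ proj₂ (split✶ (neg U) inner) ⟧* δ
          eqG = trans (cong (λ h → applyAll (neg W) (neg V ✶*) (applyAll (pos V) (neg W ⇛ neg V ✶*) h c) d)
                  (trans (cong (drop (pos V ⇛ pos W) _) eq) (drop-append (pos V ⇛ pos W) _ _ _)))
                (trans (cong (λ h → applyAll (neg W) (neg V ✶*) h d) (⟦ƛᵃ⟧ (pos V) _ a c))
                  (⟦ƛᵃ⟧ (neg W) _ ca d))
      in subst (λ r → holds K x r d) (sym eqF)
           (sound p x (append (pos U) (pos V) a c) d λ b b∈ →
             subst (λ a → holds P x a (take (neg U) (neg V) b))
               (sym (take-append (pos U) (pos V) a c))
               (hyp (take (neg U) (neg V) b)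
                 (proj₁ (∈-split✶ (neg U) (neg V) outer γ
                   (∈-≡ (⟦inst⟧ (challenge p) _ γ (⟦append⟧ _ _ γ
                     (⟦append⟧ (newˢ (pos U)) _ γ (⟦new⟧ (pos U) _ a cd)
                       (trans (⟦weaken⟧ (pos U) (newˢ (pos V)) a cd) (⟦newˢ⟧ (pos V) (neg W) cd)))
                     (trans (⟦weaken⟧ (pos U) (oldˢ (pos V)) a cd) (⟦oldˢ⟧ (pos V) (neg W) cd)))) b∈))))
             , subst (λ c → holds Q x c (drop (neg U) (neg V) b))
               (sym (drop-append (pos U) (pos V) a c))
               (hypQ (drop (neg U) (neg V) b)
                 (∈-≡ eqG (proj₂ (∈-split✶ (neg U) (neg V) inner δ
                   (∈-≡ (⟦inst⟧ (challenge p) _ δ (⟦append⟧ _ _ δ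
                     (⟦append⟧ _ _ δ
                       (trans (⟦weaken⟧ (neg W) (oldˢ (pos V)) d ca) (⟦old⟧ (pos V) (pos U) c a))
                       (trans (⟦weaken⟧ (neg W) (newˢ (pos V)) d ca) (⟦new⟧ (pos V) (pos U) c a)))
                     (⟦new⟧ (neg W) _ d ca))) b∈))))))
  }
  where
  inner : Terms✶ (neg W ++ pos V ++ pos U) ((neg U ++ neg V) ✶*)
  inner = challenge p [ ++⁺ (++⁺ (wk* (neg W) (oldˢ (pos V))) (wk* (neg W) (newˢ (pos V)))) (newˢ (neg W)) ]*
  outer : Terms✶ (pos U ++ pos V ++ neg W) ((neg U ++ neg V) ✶*)
  outer = challenge p [ ++⁺ (++⁺ (newˢ (pos U)) (wk* (pos U) (newˢ (pos V)))) (wk* (pos U) (oldˢ (pos V))) ]*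
  F : Terms✶ (pos U) (pos V ⇛ pos W)
  F = ƛᵃ (pos V) (witness p [ ++⁺ (oldˢ (pos V)) (newˢ (pos V)) ]*)
  G : Terms✶ (pos U) (pos V ⇛ neg W ⇛ neg V ✶*)
  G = ƛᵃ (pos V) (ƛᵃ (neg W) (proj₂ (split✶ (neg U) inner)))

-- A challenge `d` to `Q` challenges the implication at `a` and `d`, and `P` at every element of the
-- set that the implication computes from them.
modusPonens : {P : Pred X V} {Q : Pred X W} → (P ⊃ₚ Q) ∧ₚ P ⊢ Q
modusPonens {V = V} {W = W} {P = P} {Q = Q} = record
  { witness   = _··_ {σs = pos V} {τs = pos W} (proj₁ (++⁻ Fs (newˢ I))) (oldˢ I)
  ; challenge = append✶ (pos V ++ neg W) (singletons (++⁺ as ds)) challenges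
  ; sound     = λ x ia d hyp →
      let i  = take I (pos V) ia
          a  = drop I (pos V) ia
          γ  = append (I ++ pos V) (neg W) ia d
          ad = append (pos V) (neg W) a d
          ⟦as⟧ = trans (⟦inst⟧ (oldˢ I) ias γ (⟦new⟧ (I ++ pos V) (neg W) ia d)) (⟦oldˢ⟧ I (pos V) ia)
          ⟦is⟧ = trans (⟦inst⟧ (newˢ I) ias γ (⟦new⟧ (I ++ pos V) (neg W) ia d)) (⟦newˢ⟧ I (pos V) ia)
          ⟦ds⟧ = ⟦old⟧ (I ++ pos V) (neg W) ia d
          ⟦challenges⟧ : ⟦ challenges ⟧* γ ≡ applyAll (neg W) (neg V ✶*)
                           (applyAll (pos V) (neg W ⇛ neg V ✶*) (drop Fs Gs i) a) d
          ⟦challenges⟧ = ⟦··⟧-≡ (neg W) (neg V ✶*) (_··_ {σs = pos V} (proj₂ (++⁻ Fs is)) as) ds γ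
            (⟦··⟧-≡ (pos V) (neg W ⇛ neg V ✶*) (proj₂ (++⁻ Fs is)) as γ
              (trans (⟦++⁻⟧ʳ Fs is γ) (cong (drop Fs Gs) ⟦is⟧)) ⟦as⟧) ⟦ds⟧
          answer = λ b b∈ → hyp (append (pos V ++ neg W) (neg V) ad b)
            (∈-append✶ (pos V ++ neg W) (neg V) (singletons (++⁺ as ds)) challenges γ
              (∈-singletons-≡ (++⁺ as ds) γ (⟦append⟧ as ds γ ⟦as⟧ ⟦ds⟧)) b∈)
          -- The implication is answered only together with some challenge to `P`, so one is taken
          -- from the non-empty set; the resulting statement does not mention it.
          b₀ , b₀∈ = nonempty (neg V) (⟦ challenges ⟧* γ)
          imp : implies P Q x (take Fs Gs i) (drop Fs Gs i) a d
          imp = subst₂ (implies P Q x (take Fs Gs i) (drop Fs Gs i))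
            (trans (cong (take (pos V) (neg W)) (take-append (pos V ++ neg W) (neg V) ad b₀))
              (take-append (pos V) (neg W) a d))
            (trans (cong (drop (pos V) (neg W)) (take-append (pos V ++ neg W) (neg V) ad b₀))
              (drop-append (pos V) (neg W) a d))
            (proj₁ (answer b₀ b₀∈))
          ⟦f⟧ : ⟦ _··_ {σs = pos V} {τs = pos W} (proj₁ (++⁻ Fs (newˢ I))) (oldˢ I) ⟧* ia
                ≡ applyAll (pos V) (pos W) (take Fs Gs i) a
          ⟦f⟧ = ⟦··⟧-≡ (pos V) (pos W) (proj₁ (++⁻ Fs (newˢ I))) (oldˢ I) ia
            (trans (⟦++⁻⟧ˡ Fs (newˢ I) ia) (cong (take Fs Gs) (⟦newˢ⟧ I (pos V) ia)))
            (⟦oldˢ⟧ I (pos V) ia)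
      in subst (λ c → holds Q x c d) (sym ⟦f⟧)
           (imp λ b b∈ → subst (holds P x a) (drop-append (pos V ++ neg W) (neg V) ad b)
             (proj₂ (answer b (∈-≡ ⟦challenges⟧ b∈))))
  }
  where
  Fs = pos V ⇛ pos W
  Gs = pos V ⇛ neg W ⇛ neg V ✶*
  I  = Fs ++ Gs
  ias = newˢ {Γ = neg W} (I ++ pos V)
  is : Terms✶ ((I ++ pos V) ++ neg W) I
  is = newˢ I [ ias ]*
  as : Terms✶ ((I ++ pos V) ++ neg W) (pos V)
  as = oldˢ I [ ias ]*
  ds : Terms✶ ((I ++ pos V) ++ neg W) (neg W)
  ds = oldˢ (I ++ pos V)
  challenges : Terms✶ ((I ++ pos V) ++ neg W) (neg V ✶*)
  challenges = _··_ {σs = neg W} (_··_ {σs = pos V} {τs = neg W ⇛ neg V ✶*} (proj₂ (++⁻ Fs is)) as) ds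

⊃-elim : {P : Pred X U} {Q : Pred X V} {K : Pred X W} → P ⊢ Q ⊃ₚ K → P ⊢ Q → P ⊢ K
⊃-elim {Q = Q} {K} p q = ⊢-trans (∧-intro p q) (modusPonens {P = Q} {Q = K})

∀-intro : {P : Pred X V} {Q : Pred (Y × X) W} → reindex proj₂ P ⊢ Q → P ⊢ allₚ Q
∀-intro p = record { witness = witness p ; challenge = challenge p ; sound = λ x a d hyp y → sound p (y , x) a d hyp }

∀-elim : {P : Pred X V} {Q : Pred (Y × X) W} (t : X → Y) →
         P ⊢ allₚ Q → P ⊢ reindex (λ x → t x , x) Q
∀-elim t p = record { witness = witness p ; challenge = challenge p ; sound = λ x a d hyp → sound p x a d hyp (t x) }

-- The join lies above both witnesses, and monotonicity carries each conclusion up to it. The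
-- challenge `d` is common to both sides, so `P` is challenged on behalf of both derivations.
meet-intro : {P : Pred X V} {Q K : Pred X W} → Mono Q → Mono K →
             P ⊢ Q → P ⊢ K → P ⊢ meetₚ Q K
meet-intro {V = V} {W = W} mQ mK p q = record
  { witness   = joins (pos W) (witness p) (witness q)
  ; challenge = unions (neg V) (challenge p) (challenge q)
  ; sound     = λ x a d hyp →
      let γ = append (pos V) (neg W) a d
      in mQ x d (joins-upperˡ (pos W) (witness p) (witness q) a)
           (sound p x a d λ b b∈ → hyp b (∈-unionsˡ (neg V) (challenge p) (challenge q) γ b∈))
       , mK x d (joins-upperʳ (pos W) (witness p) (witness q) a)
           (sound q x a d λ b b∈ → hyp b (∈-unionsʳ (neg V) (challenge p) (challenge q) γ b∈))
  }

-- Induction up to a bound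

boundedₚ : Pred ℕ ((N ∷ []) , [])
boundedₚ = pred λ { n (k , _) _ → n ≤ k }

≤-closed : ∀ {P : ℕ → Set} → (∀ n → P n → P (suc n)) → ∀ {i j} → i ≤ j → P i → P j
≤-closed step {j = zero}  z≤n = id
≤-closed step {j = suc j} i≤j p with ℕₚ.m≤n⇒m<n∨m≡n i≤j
... | inj₁ (s≤s i≤j′) = step j (≤-closed step i≤j′ p)
... | inj₂ refl       = p

-- Let c, k, d be witnesses of the context, the bound and the challenge to
-- the conclusion.  The n-th iterate h n of the step, joined with its
-- predecessors, is a witness at n, so h k is one at every n ≤ k.  As the
-- step is uniform in n ≤ k, challenges at n lead to challenges at n - 1
-- for the witness h (n - 1): arguments contains all h n with n ≤ k, and
-- stage j all challenges reached from d in at most j steps.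
module Induction {X U W} {C : Pred X U} {D : Pred (ℕ × X) W} (mono : Mono D)
  (base : C ⊢ reindex (zero ,_) D)
  (step : (reindex proj₂ C ∧ₚ reindex proj₁ boundedₚ) ∧ₚ D
          ⊢ reindex (λ { (n , x) → suc n , x }) D) where

  Γ₀ : Ctx
  Γ₀ = pos U ++ N ∷ []

  Θ₀ : Ctx
  Θ₀ = Γ₀ ++ neg W

  bound : Term✶ Γ₀ N
  bound = All.lookup (oldˢ {Γ = N ∷ []} (pos U)) (here refl)

  start : Terms✶ Γ₀ (pos W)
  start = witness base [ newˢ (pos U) ]*

  next : Terms✶ (pos W ++ Γ₀) (pos W)
  next = joins (pos W) (newˢ (pos W)) (witness step [ ++⁺ (oldˢ (pos W)) (newˢ (pos W)) ]*)

  h : Env Γ₀ → ℕ → Env (pos W)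
  h = iterate (pos W) start next

  -- Adds the images under `next`. Mixed tuples arise here as well; they do no harm, since the set
  -- only indexes unions of challenges.
  nextArguments : Terms✶ ((pos W ✶*) ++ Γ₀) (pos W ✶*)
  nextArguments = unions (pos W) (newˢ (pos W ✶*)) (bigUnions (pos W) (pos W) (newˢ (pos W ✶*))
    (singletons (next [ ++⁺ (newˢ (pos W)) (wk* (pos W) (oldˢ (pos W ✶*))) ]*)))

  arguments : Terms✶ Γ₀ (pos W ✶*)
  arguments = iterateTerm (pos W ✶*) (singletons start) nextArguments bound

  -- The blocks belong to `C`, to the bound, which has no challenges, and to `D`.
  stepNeg : List Ty
  stepNeg = (neg U ++ []) ++ neg W

  -- The step is challenged at every argument in `as` with every challenge in `ds`. The part of the
  -- result for `D` feeds the next stage, the part for `C` goes to the context.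
  collect : Terms✶ Δ Γ₀ → Terms✶ Δ (pos W ✶*) → Terms✶ Δ (neg W ✶*) → Terms✶ Δ (stepNeg ✶*)
  collect cs as ds = bigUnions (pos W) stepNeg as (bigUnions (neg W) stepNeg (wk* (pos W) ds)
    (challenge step [ ++⁺ (++⁺ (wk* (neg W) (wk* (pos W) cs)) (wk* (neg W) (newˢ (pos W)))) (newˢ (neg W)) ]*))

  ∈-collect : (cs : Terms✶ Δ Γ₀) (as : Terms✶ Δ (pos W ✶*)) (ds : Terms✶ Δ (neg W ✶*)) (δ : Env Δ)
              {γ : Env Γ₀} {a : Env (pos W)} {d : Env (neg W)} {b : Env stepNeg} →
              ⟦ cs ⟧* δ ≡ γ → a ∈[ pos W ] ⟦ as ⟧* δ → d ∈[ neg W ] ⟦ ds ⟧* δ →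
              b ∈[ stepNeg ] ⟦ challenge step ⟧* (append (Γ₀ ++ pos W) (neg W) (append Γ₀ (pos W) γ a) d) →
              b ∈[ stepNeg ] ⟦ collect cs as ds ⟧* δ
  ∈-collect {Δ} cs as ds δ {a = a} {d} refl a∈ d∈ b∈ =
    let δ₁ = append (pos W) Δ a δ
        δ₂ = append (neg W) (pos W ++ Δ) d δ₁
    in ∈-bigUnions (pos W) stepNeg as _ δ a∈
         (∈-bigUnions (neg W) stepNeg (wk* (pos W) ds) _ δ₁
           (∈-≡ (⟦weaken⟧ (pos W) ds a δ) d∈)
           (∈-≡ (⟦inst⟧ (challenge step) _ δ₂ (⟦append⟧ _ (newˢ (neg W)) δ₂
             (⟦append⟧ (wk* (neg W) (wk* (pos W) cs)) (wk* (neg W) (newˢ (pos W))) δ₂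
               (trans (⟦weaken⟧ (neg W) (wk* (pos W) cs) d δ₁) (⟦weaken⟧ (pos W) cs a δ))
               (trans (⟦weaken⟧ (neg W) (newˢ (pos W)) d δ₁) (⟦new⟧ (pos W) Δ a δ)))
             (⟦new⟧ (neg W) (pos W ++ Δ) d δ₁))) b∈))

  contexts : Terms✶ Θ₀ Γ₀
  contexts = newˢ Γ₀

  nextChallenges : Terms✶ ((neg W ✶*) ++ Θ₀) (neg W ✶*)
  nextChallenges = unions (neg W) (newˢ (neg W ✶*)) (proj₂ (split✶ (neg U ++ [])
    (collect (wk* (neg W ✶*) contexts) (wk* (neg W ✶*) (arguments [ contexts ]*)) (newˢ (neg W ✶*)))))

  challenges : Terms✶ Θ₀ (neg W ✶*)
  challenges = iterateTerm (neg W ✶*) (singletons (oldˢ Γ₀)) nextChallenges (bound [ contexts ])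

  -- The descent reaches zero after a number of steps that the terms do not know, so the base is
  -- asked about the challenges of all stages.
  baseChallenges : Terms✶ Θ₀ ((neg U ++ []) ✶*)
  baseChallenges = append✶ (neg U) (bigUnions (neg W) (neg U) challenges
    (challenge base [ ++⁺ (wk* (neg W) (newˢ (pos U) [ contexts ]*)) (newˢ (neg W)) ]*)) []

  stepChallenges : Terms✶ Θ₀ ((neg U ++ []) ✶*)
  stepChallenges = proj₁ (split✶ (neg U ++ []) (collect contexts (arguments [ contexts ]*) challenges))

  contextChallenges : Terms✶ Θ₀ ((neg U ++ []) ✶*)
  contextChallenges = unions (neg U ++ []) baseChallenges stepChallenges

  module _ (γ : Env Γ₀) where

    c : Env (pos U)
    c = take (pos U) (N ∷ []) γ

    k : ℕ
    k = proj₁ (drop (pos U) (N ∷ []) γ)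

    ⟦bound⟧ : ⟦ bound ⟧ᵗ γ ≡ k
    ⟦bound⟧ = trans (⟦lookup⟧ (oldˢ {Γ = N ∷ []} (pos U)) (here refl) γ)
      (cong proj₁ (⟦oldˢ⟧ (pos U) (N ∷ []) γ))

    h-increasing : ∀ {i j} → i ≤ j → h γ i ≼*[ pos W ] h γ j
    h-increasing {i} i≤j = ≤-closed {λ j → h γ i ≼*[ pos W ] h γ j}
      (λ j p → ≼*-trans (pos W) (h γ i) (h γ j) (h γ (suc j)) p
        (subst (λ a → a ≼*[ pos W ] h γ (suc j)) (⟦new⟧ (pos W) Γ₀ (h γ j) γ)
          (joins-upperˡ (pos W) (newˢ (pos W)) _ (append (pos W) Γ₀ (h γ j) γ))))
      i≤j (≼*-refl (pos W) (h γ i))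

    argumentStage : ℕ → Env (pos W ✶*)
    argumentStage = iterate (pos W ✶*) (singletons start) nextArguments γ

    h∈argumentStage : ∀ n → h γ n ∈[ pos W ] argumentStage n
    h∈argumentStage zero    = ∈-singletons start γ
    h∈argumentStage (suc n) =
      ∈-unionsʳ (pos W) (newˢ (pos W ✶*)) _ δ
        (∈-bigUnions (pos W) (pos W) (newˢ (pos W ✶*)) _ δ
          (∈-≡ (⟦new⟧ (pos W ✶*) Γ₀ (argumentStage n) γ) (h∈argumentStage n))
          (∈-singletons-≡ (next [ _ ]*) δ₁ (⟦inst⟧ next _ δ₁ (⟦append⟧ (newˢ (pos W)) _ δ₁
            (⟦new⟧ (pos W) _ (h γ n) δ)
            (trans (⟦weaken⟧ (pos W) (oldˢ (pos W ✶*)) (h γ n) δ)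
              (⟦old⟧ (pos W ✶*) Γ₀ (argumentStage n) γ))))))
      where
      δ  = append (pos W ✶*) Γ₀ (argumentStage n) γ
      δ₁ = append (pos W) ((pos W ✶*) ++ Γ₀) (h γ n) δ

    h∈arguments : ∀ {n} → n ≤ k → h γ n ∈[ pos W ] ⟦ arguments ⟧* γ
    h∈arguments {n} n≤k =
      ∈-≡ (trans (⟦iterateTerm⟧ (pos W ✶*) (singletons start) nextArguments bound γ)
            (cong argumentStage ⟦bound⟧))
        (≤-closed {λ j → h γ n ∈[ pos W ] argumentStage j}
          (λ j p → ∈-unionsˡ (pos W) (newˢ (pos W ✶*)) _ (append (pos W ✶*) Γ₀ (argumentStage j) γ)
            (∈-≡ (⟦new⟧ (pos W ✶*) Γ₀ (argumentStage j) γ) p))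
          n≤k (h∈argumentStage n))

    module _ (d : Env (neg W)) where

      θ : Env Θ₀
      θ = append Γ₀ (neg W) γ d

      ⟦contexts⟧ : ⟦ contexts ⟧* θ ≡ γ
      ⟦contexts⟧ = ⟦new⟧ Γ₀ (neg W) γ d

      stage : ℕ → Env (neg W ✶*)
      stage = iterate (neg W ✶*) (singletons (oldˢ Γ₀)) nextChallenges θ

      stage-⊆-challenges : ∀ {j e} → j ≤ k → e ∈[ neg W ] stage j → e ∈[ neg W ] ⟦ challenges ⟧* θ
      stage-⊆-challenges {e = e} j≤k e∈ =
        ∈-≡ (trans (⟦iterateTerm⟧ (neg W ✶*) (singletons (oldˢ Γ₀)) nextChallenges _ θ)
              (cong stage (trans (⟦sub⟧ bound contexts θ) (trans (cong ⟦ bound ⟧ᵗ ⟦contexts⟧) ⟦bound⟧))))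
          (≤-closed {λ j → e ∈[ neg W ] stage j}
            (λ j p → ∈-unionsˡ (neg W) (newˢ (neg W ✶*)) _ (append (neg W ✶*) Θ₀ (stage j) θ)
              (∈-≡ (⟦new⟧ (neg W ✶*) Θ₀ (stage j) θ) p))
            j≤k e∈)

      StepChallenge : ℕ → Env (neg W) → Env stepNeg → Set
      StepChallenge n e b = b ∈[ stepNeg ]
        ⟦ challenge step ⟧* (append (Γ₀ ++ pos W) (neg W) (append Γ₀ (pos W) γ (h γ n)) e)

      challenge-succ : ∀ {n j e b} → n ≤ k → e ∈[ neg W ] stage j → StepChallenge n e b →
                       drop (neg U ++ []) (neg W) b ∈[ neg W ] stage (suc j)
      challenge-succ {j = j} n≤k e∈ b∈ =
        ∈-unionsʳ (neg W) (newˢ (neg W ✶*)) _ δ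
          (proj₂ (∈-split✶ (neg U ++ []) (neg W) _ δ
            (∈-collect (wk* (neg W ✶*) contexts) _ (newˢ (neg W ✶*)) δ
              (trans (⟦weaken⟧ (neg W ✶*) contexts (stage j) θ) ⟦contexts⟧)
              (∈-≡ (trans (⟦weaken⟧ (neg W ✶*) (arguments [ contexts ]*) (stage j) θ)
                     (⟦inst⟧ arguments contexts θ ⟦contexts⟧)) (h∈arguments n≤k))
              (∈-≡ (⟦new⟧ (neg W ✶*) Θ₀ (stage j) θ) e∈)
              b∈)))
        where δ = append (neg W ✶*) Θ₀ (stage j) θ

      ∈-baseChallenges : ∀ {j e b} → j ≤ k → e ∈[ neg W ] stage j →
                         b ∈[ neg U ] ⟦ challenge base ⟧* (append (pos U) (neg W) c e) →
                         append (neg U) [] b tt ∈[ neg U ++ [] ] ⟦ contextChallenges ⟧* θ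
      ∈-baseChallenges {e = e} j≤k e∈ b∈ =
        ∈-unionsˡ (neg U ++ []) baseChallenges stepChallenges θ
          (∈-append✶ (neg U) [] _ [] θ
            (∈-bigUnions (neg W) (neg U) challenges _ θ (stage-⊆-challenges j≤k e∈)
              (∈-≡ (⟦inst⟧ (challenge base) _ δ (⟦append⟧ _ (newˢ (neg W)) δ
                (trans (⟦weaken⟧ (neg W) (newˢ (pos U) [ contexts ]*) e θ)
                  (trans (⟦inst⟧ (newˢ (pos U)) contexts θ ⟦contexts⟧) (⟦newˢ⟧ (pos U) (N ∷ []) γ)))
                (⟦new⟧ (neg W) Θ₀ e θ))) b∈))
            tt)
        where δ = append (neg W) Θ₀ e θ

      ∈-stepChallenges : ∀ {n j e b} → n ≤ k → j ≤ k → e ∈[ neg W ] stage j → StepChallenge n e b →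
                         take (neg U ++ []) (neg W) b ∈[ neg U ++ [] ] ⟦ contextChallenges ⟧* θ
      ∈-stepChallenges n≤k j≤k e∈ b∈ =
        ∈-unionsʳ (neg U ++ []) baseChallenges stepChallenges θ
          (proj₁ (∈-split✶ (neg U ++ []) (neg W) _ θ
            (∈-collect contexts (arguments [ contexts ]*) challenges θ ⟦contexts⟧
              (∈-≡ (⟦inst⟧ arguments contexts θ ⟦contexts⟧) (h∈arguments n≤k))
              (stage-⊆-challenges j≤k e∈) b∈)))

      module _ (x : X) (hyp : ∀ b → b ∈[ neg U ++ [] ] ⟦ contextChallenges ⟧* θ →
                              holds C x c (take (neg U) [] b)) where

        -- Descending from n + 1 to n moves a challenge from stage j to stage j + 1, so the sum n +
        -- j is preserved. Its bound k keeps the arguments among h 0, ..., h k and the challenges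
        -- within the first k stages.
        h-correct : ∀ n j → n + j ≤ k → ∀ {e} → e ∈[ neg W ] stage j → holds D (n , x) (h γ n) e
        h-correct zero    j j≤k {e} e∈ =
          subst (λ a → holds D (zero , x) a e)
            (sym (⟦inst⟧ (witness base) (newˢ (pos U)) γ (⟦newˢ⟧ (pos U) (N ∷ []) γ)))
            (sound base x c e λ b b∈ →
              subst (holds C x c) (take-append (neg U) [] b tt) (hyp _ (∈-baseChallenges j≤k e∈ b∈)))
        h-correct (suc n) j n+j<k {e} e∈ =
          -- The witness that the step produces from `h γ n` is one of the two parts joined in
          -- `h γ (suc n)`.
          mono (suc n , x) e
            (subst (λ a → a ≼*[ pos W ] h γ (suc n))
              (⟦inst⟧ (witness step) _ (append (pos W) Γ₀ (h γ n) γ) (⟦append⟧ _ (newˢ (pos W)) _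
                (⟦old⟧ (pos W) Γ₀ (h γ n) γ) (⟦new⟧ (pos W) Γ₀ (h γ n) γ)))
              (joins-upperʳ (pos W) (newˢ (pos W)) _ (append (pos W) Γ₀ (h γ n) γ)))
            (sound step (n , x) (append Γ₀ (pos W) γ (h γ n)) e λ b b∈ →
              ( subst (λ γ′ → holds C x (take (pos U) (N ∷ []) γ′) (take (neg U) [] (take (neg U ++ []) (neg W) b)))
                  (sym (take-append Γ₀ (pos W) γ (h γ n)))
                  (hyp _ (∈-stepChallenges {j = j} n≤k j≤k e∈ b∈))
              , subst (λ γ′ → n ≤ proj₁ (drop (pos U) (N ∷ []) γ′))
                  (sym (take-append Γ₀ (pos W) γ (h γ n))) n≤k )
              , subst (λ a → holds D (n , x) a (drop (neg U ++ []) (neg W) b))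
                  (sym (drop-append Γ₀ (pos W) γ (h γ n)))
                  (h-correct n (suc j) (subst (_≤ k) (sym (ℕₚ.+-suc n j)) n+j<k)
                    (challenge-succ {j = j} n≤k e∈ b∈)))
          where
          n≤k = ℕₚ.≤-trans (ℕₚ.m≤n⇒m≤1+n (ℕₚ.m≤m+n n j)) n+j<k
          j≤k = ℕₚ.≤-trans (ℕₚ.m≤n+m j (suc n)) n+j<k

  induct : reindex proj₂ C ∧ₚ reindex proj₁ boundedₚ ⊢ D
  induct = record
    { witness   = iterateTerm (pos W) start next bound
    ; challenge = contextChallenges
    ; sound     = λ { (n , x) γ d hyp →
        -- The inequality n ≤ k comes only as a component of an answer, so an arbitrary challenge is
        -- posed to obtain it.
        let b₀ , b₀∈ = nonempty (neg U ++ []) (⟦ contextChallenges ⟧* (θ γ d))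
            n≤k = proj₂ (hyp b₀ b₀∈)
        in subst (λ a → holds D (n , x) a d)
             (sym (trans (⟦iterateTerm⟧ (pos W) start next bound γ) (cong (h γ) (⟦bound⟧ γ))))
             (mono (n , x) d (h-increasing γ n≤k)
               (h-correct γ d x (λ b b∈ → proj₁ (hyp b b∈)) n 0
                 (subst (_≤ k γ) (sym (ℕₚ.+-identityʳ n)) n≤k)
                 (∈-singletons-≡ (oldˢ Γ₀) (θ γ d) (⟦old⟧ Γ₀ (neg W) γ d)))) }
    }

open Induction using (induct)

-- Satisfaction

≡⇒⇔ : {P Q : Set} → P ≡ Q → P ⇔ Q
≡⇒⇔ refl = mk⇔ id id

∀-cong-⇔ : {A : Set} {P Q : A → Set} → (∀ x → P x ⇔ Q x) → (∀ x → P x) ⇔ (∀ x → Q x)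
∀-cong-⇔ h = mk⇔ (λ p x → Equivalence.to (h x) (p x)) (λ q x → Equivalence.from (h x) (q x))

∃-cong-⇔ : {A : Set} {P Q : A → Set} → (∀ x → P x ⇔ Q x) → ∃ P ⇔ ∃ Q
∃-cong-⇔ h = mk⇔ (map₂ (Equivalence.to (h _))) (map₂ (Equivalence.from (h _)))

⊨-sub : (A : Formula✶ Γ) (s : Terms✶ Δ Γ) (δ : Env Δ) → (δ ⊨ A [ s ]ᶠ) ⇔ (⟦ s ⟧* δ ⊨ A)
⊨-sub (_≐_ {σ} t u)                s δ = ≡⇒⇔ (cong₂ (_≈_ {σ}) (⟦sub⟧ t s δ) (⟦sub⟧ u s δ))
⊨-sub (rel (mem {σ}) (t ∷ u ∷ [])) s δ = ≡⇒⇔ (cong₂ (_∈ˢ_ {σ}) (⟦sub⟧ t s δ) (⟦sub⟧ u s δ))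
⊨-sub ⊥ᶠ        s δ = mk⇔ id id
⊨-sub (A₁ ∧ A₂) s δ = ⊨-sub A₁ s δ ×-⇔ ⊨-sub A₂ s δ
⊨-sub (A₁ ⊃ A₂) s δ = →-cong-⇔ (⊨-sub A₁ s δ) (⊨-sub A₂ s δ)
⊨-sub (all _ A) s δ = ∀-cong-⇔ λ x →
  ≡⇒⇔ (cong (_⊨ A) (⟦lift⟧ s x δ)) ⇔-∘ ⊨-sub A (lift s) (x , δ)
⊨-sub (ex _ A)  s δ = ∃-cong-⇔ λ x →
  ≡⇒⇔ (cong (_⊨ A) (⟦lift⟧ s x δ)) ⇔-∘ ⊨-sub A (lift s) (x , δ)

∀∈-⇔ : ∀ {Γ} τs (Xs : Terms✶ Γ (τs ✶*)) (A : Formula✶ (τs ++ Γ)) (γ : Env Γ) →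
       (γ ⊨ ∀∈ τs Xs A) ⇔ (∀ xs → xs ∈[ τs ] ⟦ Xs ⟧* γ → append τs Γ xs γ ⊨ A)
∀∈-⇔     []       []       A γ = mk⇔ (λ p _ _ → p) (λ p → p tt tt)
∀∈-⇔ {Γ} (τ ∷ τs) (X ∷ Xs) A γ =
  mk⇔ (λ p (x , xs) (q , qs) → p xs qs x (Equivalence.from (member x xs) q))
      (λ p xs qs x q → p (x , xs) (Equivalence.to (member x xs) q , qs))
  ⇔-∘ ∀∈-⇔ τs Xs _ γ
  where
  member : ∀ x xs → _∈ˢ_ {τ} x (⟦ wk (τ ∷ τs) X ⟧ᵗ (x , append τs Γ xs γ)) ⇔ _∈ˢ_ {τ} x (⟦ X ⟧ᵗ γ)
  member x xs = ≡⇒⇔ (cong (_∈ˢ_ {τ} x)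
    (trans (⟦wk⟧ (τ ∷ τs) X (x , append τs Γ xs γ)) (cong ⟦ X ⟧ᵗ (drop-append τs Γ xs γ))))

close-intro : (A : Formula✶ Γ) → (∀ γ → γ ⊨ A) → T (close {Γ = Γ} A)
close-intro {Γ = []}    A h = h tt
close-intro {Γ = σ ∷ Γ} A h = close-intro {Γ = Γ} (all tt A) λ γ x → h (x , γ)

cong₃ : ∀ {A B C : Set} {D : Set₁} (F : A → B → C → D) {a a′ b b′ c c′} →
        a ≡ a′ → b ≡ b′ → c ≡ c′ → F a b c ≡ F a′ b′ c′
cong₃ F refl refl refl = refl

-- `A` and `B` are arbitrary because two clauses have this shape: implication in `⟨_⟩` and function
-- types in `formulaᶜᵇ`.
implies-⇔ : ∀ {V W : WitnessTypes} (P : Pred X V) (Q : Pred X W) (x : X)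
            (fg : Terms✶ Δ (pos (V ⊃ᵂ W))) (ad : Terms✶ Δ (pos V ++ neg W)) (δ : Env Δ)
            {A : Formula✶ (neg V ++ Δ)} {B : Formula✶ Δ} →
            let f , g = ++⁻ (pos V ⇛ pos W) fg
                a , d = ++⁻ (pos V) ad
            in (∀ b → (append (neg V) Δ b δ ⊨ A) ⇔ holds P x (⟦ a ⟧* δ) b) →
               ((δ ⊨ B) ⇔ holds Q x (⟦ _··_ {σs = pos V} {τs = pos W} f a ⟧* δ) (⟦ d ⟧* δ)) →
               (δ ⊨ ∀∈ (neg V) (_··_ {σs = neg W} (_··_ {σs = pos V} {τs = neg W ⇛ neg V ✶*} g a) d) A ⊃ B)
               ⇔ holds (P ⊃ₚ Q) x (⟦ fg ⟧* δ) (⟦ ad ⟧* δ)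
implies-⇔ {V = V} {W = W} P Q x fg ad δ {A} hA hB = →-cong-⇔
  ((∀-cong-⇔ λ b → →-cong-⇔
      (≡⇒⇔ (cong (Mem (neg V) b)
        (⟦··⟧-≡ (neg W) (neg V ✶*) (_··_ {σs = pos V} g a) d δ
          (⟦··⟧-≡ (pos V) (neg W ⇛ neg V ✶*) g a δ (⟦++⁻⟧ʳ (pos V ⇛ pos W) fg δ) ⟦a⟧)
          ⟦d⟧)))
      (≡⇒⇔ (cong (λ a → holds P x a b) ⟦a⟧) ⇔-∘ hA b))
    ⇔-∘ ∀∈-⇔ (neg V) _ A δ)
  (≡⇒⇔ (cong₂ (holds Q x)
     (⟦··⟧-≡ (pos V) (pos W) f a δ (⟦++⁻⟧ˡ (pos V ⇛ pos W) fg δ) ⟦a⟧) ⟦d⟧)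
   ⇔-∘ hB)
  where
  f = proj₁ (++⁻ (pos V ⇛ pos W) fg)
  g = proj₂ (++⁻ (pos V ⇛ pos W) fg)
  a = proj₁ (++⁻ (pos V) ad)
  d = proj₂ (++⁻ (pos V) ad)
  ⟦a⟧ = ⟦++⁻⟧ˡ (pos V) ad δ
  ⟦d⟧ = ⟦++⁻⟧ʳ (pos V) ad δ

-- The 𝒰-interpretation in the structure

𝐈 : (h : HAType σ) → Pred (El σ) (witᶜᵇ h)
𝐈 N       = boundedₚ
𝐈 B       = ⊤ₚ
𝐈 (h ⇒ k) = allₚ (reindex proj₁ (𝐈 h) ⊃ₚ reindex (λ { (x , f) → f ⟨$⟩ x }) (𝐈 k))

𝐈-mono : (h : HAType σ) → Mono (𝐈 h)
𝐈-mono N       n b (k≤l , _) n≤k = ℕₚ.≤-trans n≤k k≤l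
𝐈-mono B       i b _ _ = tt
𝐈-mono {σ = ρ ⇒ σ} (h ⇒ k) f b p q x =
  ⊃ₚ-mono {P = reindex proj₁ (𝐈 h)} {Q = reindex (λ { (x , f) → f ⟨$⟩ x }) (𝐈 k)}
    (λ { (x , f) → 𝐈-mono k (f ⟨$⟩ x) }) (x , f) b p (q x)

𝐈-cong : (h : HAType σ) {x y : El σ} → _≈_ {σ} x y → ∀ {a b} →
         holds (𝐈 h) x a b → holds (𝐈 h) y a b
𝐈-cong N       refl p = p
𝐈-cong B       _    p = p
𝐈-cong (h ⇒ k) f≈g  p x q = 𝐈-cong k (f≈g x) (p x q)

≤ᶠ-⇔ : (t u : Term✶ Γ N) (γ : Env Γ) → (γ ⊨ t ≤ᶠ u) ⇔ (⟦ t ⟧ᵗ γ ≤ ⟦ u ⟧ᵗ γ)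
≤ᶠ-⇔ t u γ =
  mk⇔ (λ (z , p) → subst (⟦ t ⟧ᵗ γ ≤_) p (ℕₚ.m≤n+m (⟦ t ⟧ᵗ γ) z))
      (λ p → ⟦ u ⟧ᵗ γ ∸ ⟦ t ⟧ᵗ γ , ℕₚ.m∸n+n≡m p)
  ⇔-∘ ∃-cong-⇔ λ z → ≡⇒⇔ (cong₂ _≡_
    (trans (recurse-suc z _) (cong (z +_) (⟦wk⟧ (N ∷ []) t (z , γ))))
    (⟦wk⟧ (N ∷ []) u (z , γ)))
  where
  -- The sum in `_≤ᶠ_` is a recursor; it evaluates to the z-fold successor of n.
  recurse-suc : ∀ z n →
    proj₁ (recurse (N ∷ []) z (n , tt)
      (⟦_⟧ᵗ {Γ = []} (con (base (Π {σ = N ⇒ N} {τ = N} tt tt)) · con (base S)) tt , tt)) ≡ z + n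
  recurse-suc zero    n = refl
  recurse-suc (suc z) n = cong suc (recurse-suc z n)

formulaᶜᵇ-⇔ : (h : HAType σ) (t : Term✶ Δ σ) (a : Terms✶ Δ (pos (witᶜᵇ h)))
              (b : Terms✶ Δ (neg (witᶜᵇ h))) (δ : Env Δ) →
              (δ ⊨ formulaᶜᵇ h t a b) ⇔ holds (𝐈 h) (⟦ t ⟧ᵗ δ) (⟦ a ⟧* δ) (⟦ b ⟧* δ)
formulaᶜᵇ-⇔ N t (n ∷ []) [] δ = ≤ᶠ-⇔ t n δ
formulaᶜᵇ-⇔ B t []       [] δ = mk⇔ (λ _ → tt) (λ _ → id)
formulaᶜᵇ-⇔ {σ = ρ ⇒ σ} {Δ} (h ⇒ k) t fg ad δ = ∀-cong-⇔ λ x →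
  let δ₁ = x , δ
      P  = reindex proj₁ (𝐈 h)
      Q  = reindex (λ { (x , f) → f ⟨$⟩ x }) (𝐈 k)
      f  = proj₁ (++⁻ (pos (witᶜᵇ h) ⇛ pos (witᶜᵇ k)) (wk* (ρ ∷ []) fg))
      a  = proj₁ (++⁻ (pos (witᶜᵇ h)) (wk* (ρ ∷ []) ad))
      d  = proj₂ (++⁻ (pos (witᶜᵇ h)) (wk* (ρ ∷ []) ad))
  in ≡⇒⇔ (cong₂ (holds (P ⊃ₚ Q) (x , ⟦ t ⟧ᵗ δ)) (⟦wk⟧* (ρ ∷ []) fg δ₁) (⟦wk⟧* (ρ ∷ []) ad δ₁))
     ⇔-∘ implies-⇔ P Q (x , ⟦ t ⟧ᵗ δ) (wk* (ρ ∷ []) fg) (wk* (ρ ∷ []) ad) δ₁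
       {B = formulaᶜᵇ k (wk (ρ ∷ []) t · v₀) (_··_ {σs = pos (witᶜᵇ h)} f a) d}
       (λ b → let δ₂ = append (neg (witᶜᵇ h)) (ρ ∷ Δ) b δ₁ in
         ≡⇒⇔ (cong₃ (holds (𝐈 h))
           (trans (⟦wk⟧ {Γ = ρ ∷ Δ} (neg (witᶜᵇ h)) v₀ δ₂)
             (cong proj₁ (drop-append (neg (witᶜᵇ h)) (ρ ∷ Δ) b δ₁)))
           (⟦weaken⟧ (neg (witᶜᵇ h)) a b δ₁)
           (⟦new⟧ (neg (witᶜᵇ h)) (ρ ∷ Δ) b δ₁))
         ⇔-∘ formulaᶜᵇ-⇔ h (wk (neg (witᶜᵇ h)) v₀) (wk* (neg (witᶜᵇ h)) a) (newˢ (neg (witᶜᵇ h))) δ₂)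
       (≡⇒⇔ (cong (λ f → holds (𝐈 k) (f ⟨$⟩ x) _ _) (⟦wk⟧ (ρ ∷ []) t δ₁))
         ⇔-∘ formulaᶜᵇ-⇔ k (wk (ρ ∷ []) t · v₀) _ _ δ₁)

open 𝒰 𝓘ᶜᵇ

sem : (A : Formula 𝓛ᴵ Γ) → Pred (Env Γ) (wit A)
sem (_≐_ {σ} t u)         = pred λ γ _ _ → _≈_ {σ} (⟦ ⌜ t ⌝ ⟧ᵗ γ) (⟦ ⌜ u ⌝ ⟧ᵗ γ)
sem (rel (𝓘 h) (t ∷ [])) = reindex ⟦ ⌜ t ⌝ ⟧ᵗ (𝐈 h)
sem ⊥ᶠ                   = pred λ _ _ _ → ⊥
sem (A₁ ∧ A₂)            = sem A₁ ∧ₚ sem A₂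
sem (A₁ ⊃ A₂)            = sem A₁ ⊃ₚ sem A₂
sem (all _ A)            = allₚ (sem A)
sem (ex _ A)             = exₚ (sem A)

-- The bridge from the syntactic interpretation to predicates, through which every entailment
-- becomes a statement about `⟨_⟩`.
⟨⟩-⇔ : (A : Formula 𝓛ᴵ Γ) (s : Terms✶ Δ Γ) (a : Terms✶ Δ (pos (wit A)))
       (b : Terms✶ Δ (neg (wit A))) (δ : Env Δ) →
       (δ ⊨ ⟨ A ⟩ s a b) ⇔ holds (sem A) (⟦ s ⟧* δ) (⟦ a ⟧* δ) (⟦ b ⟧* δ)
⟨⟩-⇔ (_≐_ {σ} t u) s a b δ = ≡⇒⇔ (cong₂ (_≈_ {σ}) (⟦sub⟧ ⌜ t ⌝ s δ) (⟦sub⟧ ⌜ u ⌝ s δ))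
⟨⟩-⇔ (rel (𝓘 {σ} h) (t ∷ [])) s a b δ =
  let p    = pos (witᶜᵇ h)
      n    = neg (witᶜᵇ h)
      x    = ⟦ ⌜ t ⌝ [ s ] ⟧ᵗ δ
      γ    = x , ⟦ ++⁺ a b ⟧* δ
      vars = wk* (σ ∷ []) (idˢ {Γ = p ++ n})
      ⟦vars⟧ : ⟦ vars ⟧* γ ≡ append p n (⟦ a ⟧* δ) (⟦ b ⟧* δ)
      ⟦vars⟧ = trans (⟦wk⟧* (σ ∷ []) (idˢ {Γ = p ++ n}) γ)
        (trans (⟦idˢ⟧ (p ++ n) (⟦ ++⁺ a b ⟧* δ)) (⟦++⁺⟧ a b δ))
  in ≡⇒⇔ (cong₃ (holds (𝐈 h)) (⟦sub⟧ ⌜ t ⌝ s δ)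
       (trans (⟦++⁻⟧ˡ p vars γ) (trans (cong (take p n) ⟦vars⟧) (take-append p n _ _)))
       (trans (⟦++⁻⟧ʳ p vars γ) (trans (cong (drop p n) ⟦vars⟧) (drop-append p n _ _))))
     ⇔-∘ (formulaᶜᵇ-⇔ h v₀ (proj₁ (++⁻ p vars)) (proj₂ (++⁻ p vars)) γ
     ⇔-∘ ⊨-sub (BaseInterpretation.formula 𝓘ᶜᵇ h) (⌜ t ⌝ [ s ] ∷ ++⁺ a b) δ)
⟨⟩-⇔ ⊥ᶠ        s a b δ = mk⇔ id id
⟨⟩-⇔ (A₁ ∧ A₂) s ac bd δ =
  (≡⇒⇔ (cong₂ (holds (sem A₁) (⟦ s ⟧* δ)) (⟦++⁻⟧ˡ (pos (wit A₁)) ac δ) (⟦++⁻⟧ˡ (neg (wit A₁)) bd δ))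
    ⇔-∘ ⟨⟩-⇔ A₁ s _ _ δ)
  ×-⇔
  (≡⇒⇔ (cong₂ (holds (sem A₂) (⟦ s ⟧* δ)) (⟦++⁻⟧ʳ (pos (wit A₁)) ac δ) (⟦++⁻⟧ʳ (neg (wit A₁)) bd δ))
    ⇔-∘ ⟨⟩-⇔ A₂ s _ _ δ)
⟨⟩-⇔ {Δ = Δ} (A₁ ⊃ A₂) s fg ad δ =
  let βs = neg (wit A₁)
      f  = proj₁ (++⁻ (pos (wit A₁) ⇛ pos (wit A₂)) fg)
      a  = proj₁ (++⁻ (pos (wit A₁)) ad)
      d  = proj₂ (++⁻ (pos (wit A₁)) ad)
  in implies-⇔ (sem A₁) (sem A₂) (⟦ s ⟧* δ) fg ad δ {B = ⟨ A₂ ⟩ s (_··_ {σs = pos (wit A₁)} f a) d}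
       (λ b → let δ₁ = append βs Δ b δ in
         ≡⇒⇔ (cong₃ (holds (sem A₁)) (⟦weaken⟧ βs s b δ) (⟦weaken⟧ βs a b δ) (⟦new⟧ βs Δ b δ))
         ⇔-∘ ⟨⟩-⇔ A₁ (wk* βs s) (wk* βs a) (newˢ βs) δ₁)
       (⟨⟩-⇔ A₂ s _ _ δ)
⟨⟩-⇔ (all {σ} _ A) s a b δ = ∀-cong-⇔ λ x →
  ≡⇒⇔ (cong₃ (holds (sem A)) (⟦lift⟧ s x δ) (⟦wk⟧* (σ ∷ []) a (x , δ)) (⟦wk⟧* (σ ∷ []) b (x , δ)))
  ⇔-∘ ⟨⟩-⇔ A (lift s) (wk* (σ ∷ []) a) (wk* (σ ∷ []) b) (x , δ)
⟨⟩-⇔ {Δ = Δ} (ex {σ} _ A) s a bs δ =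
  let βs = neg (wit A) in
  ∃-cong-⇔ λ x →
    (∀-cong-⇔ λ b → let δ₁ = append βs (σ ∷ Δ) b (x , δ) in
      →-cong-⇔ (≡⇒⇔ (cong (Mem βs b) (⟦wk⟧* (σ ∷ []) bs (x , δ))))
        (≡⇒⇔ (cong₃ (holds (sem A))
          (trans (⟦weaken⟧ βs (lift s) b (x , δ)) (⟦lift⟧ s x δ))
          (trans (⟦weaken⟧ βs (wk* (σ ∷ []) a) b (x , δ)) (⟦wk⟧* (σ ∷ []) a (x , δ)))
          (⟦new⟧ βs (σ ∷ Δ) b (x , δ)))
        ⇔-∘ ⟨⟩-⇔ A (wk* βs (lift s)) (wk* βs (wk* (σ ∷ []) a)) (newˢ βs) δ₁))
    ⇔-∘ ∀∈-⇔ βs (wk* (σ ∷ []) bs) _ (x , δ)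

-- Since `⊤ₚ` has no positive witnesses, the terms of such an entailment are closed.
interpret : (A : Formula 𝓛ᴵ []) → ⊤ₚ ⊢ sem A → 𝒰-interpretable A
interpret A p = witness p , close-intro (⟨ A ⟩ (oldˢ n) (witness p [ [] ]*) (newˢ n)) λ γ →
  Equivalence.from (⟨⟩-⇔ A (oldˢ n) (witness p [ [] ]*) (newˢ n) γ)
    (subst (λ a → holds (sem A) tt a (⟦ newˢ n ⟧* γ)) (sym (⟦sub⟧* (witness p) [] γ))
      (sound p tt tt (⟦ newˢ n ⟧* γ) λ _ _ → tt))
  where n = neg (wit A)

sem-mono : (A : Formula 𝓛ᴵ Γ) → Mono (sem A)
sem-mono (t ≐ u)              γ b _ p = p
sem-mono (rel (𝓘 h) (t ∷ [])) γ b q p = 𝐈-mono h (⟦ ⌜ t ⌝ ⟧ᵗ γ) b q p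
sem-mono ⊥ᶠ                   γ b _ p = p
sem-mono (A₁ ∧ A₂)            = ∧ₚ-mono {P = sem A₁} {Q = sem A₂} (sem-mono A₁) (sem-mono A₂)
sem-mono (A₁ ⊃ A₂)            = ⊃ₚ-mono {P = sem A₁} {Q = sem A₂} (sem-mono A₂)
sem-mono (all _ A)            γ b q p x = sem-mono A (x , γ) b q (p x)
sem-mono (ex _ A)             γ b q (x , p) = x , λ c c∈ → sem-mono A (x , γ) c q (p c c∈)

-- Equal values satisfy a formula with the very same witnesses and challenges, so replacing equals
-- by equals calls for no new term.
sem-cong : (A : Formula 𝓛ᴵ Γ) {γ δ : Env Γ} → _≈ᴱ_ {Γ} γ δ → ∀ {a b} →
           holds (sem A) γ a b → holds (sem A) δ a b
sem-cong (_≐_ {σ} t u) γ≈δ p =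
  Setoid.trans ⟦ σ ⟧ (Setoid.sym ⟦ σ ⟧ (⟦⟧-cong ⌜ t ⌝ γ≈δ)) (Setoid.trans ⟦ σ ⟧ p (⟦⟧-cong ⌜ u ⌝ γ≈δ))
sem-cong (rel (𝓘 h) (t ∷ [])) γ≈δ p = 𝐈-cong h (⟦⟧-cong ⌜ t ⌝ γ≈δ) p
sem-cong ⊥ᶠ        γ≈δ p       = p
sem-cong (A₁ ∧ A₂) γ≈δ (p , q) = sem-cong A₁ γ≈δ p , sem-cong A₂ γ≈δ q
sem-cong {Γ} (A₁ ⊃ A₂) γ≈δ p q =
  sem-cong A₂ γ≈δ (p λ b b∈ → sem-cong A₁ (Setoid.sym (Envₛ Γ) γ≈δ) (q b b∈))
sem-cong (all {σ} _ A) γ≈δ p x = sem-cong A (Setoid.refl ⟦ σ ⟧ , γ≈δ) (p x)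
sem-cong (ex {σ} _ A) γ≈δ (x , p) = x , λ b b∈ → sem-cong A (Setoid.refl ⟦ σ ⟧ , γ≈δ) (p b b∈)

-- Substitution

-- Substitution leaves the witness types of a formula unchanged, but only by induction on the
-- formula. With both types as indices, matching on `pointwise` supplies that equality clause by
-- clause and avoids transports.
data _≋_ {X : Set} : Pred X V → Pred X W → Set₁ where
  pointwise : {P Q : Pred X W} → (∀ x a b → holds P x a b ⇔ holds Q x a b) → P ≋ Q

∧-≋ : {P : Pred X U} {P′ : Pred X V} {W W′ : WitnessTypes} {Q : Pred X W} {Q′ : Pred X W′} →
      P ≋ P′ → Q ≋ Q′ → (P ∧ₚ Q) ≋ (P′ ∧ₚ Q′)
∧-≋ (pointwise p) (pointwise q) = pointwise λ x ac bd → p x _ _ ×-⇔ q x _ _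

⊃-≋ : {P : Pred X U} {P′ : Pred X V} {W W′ : WitnessTypes} {Q : Pred X W} {Q′ : Pred X W′} →
      P ≋ P′ → Q ≋ Q′ → (P ⊃ₚ Q) ≋ (P′ ⊃ₚ Q′)
⊃-≋ (pointwise p) (pointwise q) = pointwise λ x fg ad →
  →-cong-⇔ (∀-cong-⇔ λ b → →-cong-⇔ (mk⇔ id id) (p x _ b)) (q x _ _)

all-≋ : {P : Pred (Y × X) V} {Q : Pred (Y × X) W} → P ≋ Q → allₚ P ≋ allₚ Q
all-≋ (pointwise p) = pointwise λ x a b → ∀-cong-⇔ λ y → p (y , x) a b

ex-≋ : {P : Pred (Y × X) V} {Q : Pred (Y × X) W} → P ≋ Q → exₚ P ≋ exₚ Q
ex-≋ (pointwise p) = pointwise λ x a bs → ∃-cong-⇔ λ y →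
  ∀-cong-⇔ λ b → →-cong-⇔ (mk⇔ id id) (p (y , x) a b)

≋⇒⊢ : {P : Pred X V} {Q : Pred X W} → P ≋ Q → P ⊢ Q
≋⇒⊢ (pointwise h) = ⊢-pointwise λ x a b → Equivalence.to (h x a b)

≋⇒⊣ : {P : Pred X V} {Q : Pred X W} → P ≋ Q → Q ⊢ P
≋⇒⊣ (pointwise h) = ⊢-pointwise λ x a b → Equivalence.from (h x a b)

-- Records the map of environments that a substitution induces, so that substitution in a formula
-- becomes `reindex`.
Denotes : Terms (Con HAType) Δ Γ → (Env Δ → Env Γ) → Set
Denotes {Δ} {Γ} s φ = ∀ δ {σ} (i : σ ∈ˡ Γ) → ⟦ ⌜ All.lookup s i ⌝ ⟧ᵗ δ ≡ lookup i (φ δ)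

tabulate-denotes : ∀ {Δ} (t : ∀ {σ} → σ ∈ˡ Γ → Term (Con HAType) Δ σ) {φ : Env Δ → Env Γ} →
                   (∀ δ {σ} (i : σ ∈ˡ Γ) → ⟦ ⌜ t i ⌝ ⟧ᵗ δ ≡ lookup i (φ δ)) →
                   Denotes (All.tabulate t) φ
tabulate-denotes {Γ = _ ∷ _} t h δ (here refl) = h δ (here refl)
tabulate-denotes {Γ = _ ∷ _} t h δ (there i)   =
  tabulate-denotes (t ∘ there) (λ δ i → h δ (there i)) δ i

old-denotes : ∀ σs Γ → Denotes (oldˢ {Γ = Γ} σs) (drop σs Γ)
old-denotes σs Γ = tabulate-denotes (var ∘ ∈-++⁺ʳ σs) (λ δ i → lookup-drop σs Γ i δ)

new-denotes : ∀ σs Γ → Denotes (newˢ {Γ = Γ} σs) (take σs Γ)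
new-denotes σs Γ = tabulate-denotes (var ∘ ∈-++⁺ˡ) (λ δ i → lookup-take σs Γ i δ)

id-denotes : ∀ Γ → Denotes (idˢ {Γ = Γ}) id
id-denotes Γ = tabulate-denotes var (λ _ _ → refl)

wk-denotes : ∀ σs (s : Terms (Con HAType) Δ Γ) {φ} → Denotes s φ →
             Denotes (wk* σs s) (φ ∘ drop σs Δ)
wk-denotes {Δ} σs s h δ i = trans (cong (λ t → ⟦ ⌜ t ⌝ ⟧ᵗ δ) (lookup-map s i))
  (trans (⟦⌜sub⌝⟧ (All.lookup s i) (oldˢ σs) δ (drop σs Δ δ) (old-denotes σs Δ δ)) (h (drop σs Δ δ) i))

∷-denotes : ∀ {Δ} (t : Term (Con HAType) Δ σ) (s : Terms (Con HAType) Δ Γ) {x : Env Δ → El σ} {φ} →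
            (∀ δ → ⟦ ⌜ t ⌝ ⟧ᵗ δ ≡ x δ) → Denotes s φ → Denotes (t ∷ s) (λ δ → x δ , φ δ)
∷-denotes t s p q δ (here refl) = p δ
∷-denotes t s p q δ (there i)   = q δ i

lift-denotes : ∀ σ (s : Terms (Con HAType) Δ Γ) {φ} → Denotes s φ →
               Denotes (lift {σ = σ} s) (λ { (x , δ) → x , φ δ })
lift-denotes σ s h = ∷-denotes v₀ (wk* (σ ∷ []) s) (λ _ → refl) (wk-denotes (σ ∷ []) s h)

sub-≋ : (A : Formula HAω Γ) (s : Terms (Con HAType) Δ Γ) {φ : Env Δ → Env Γ} → Denotes s φ →
        sem ((A [ s ]ᶠ) ᴵ) ≋ reindex φ (sem (A ᴵ))
sub-≋ (_≐_ {σ} t u) s {φ} h = pointwise λ δ _ _ →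
  ≡⇒⇔ (cong₂ (_≈_ {σ}) (⟦⌜sub⌝⟧ t s δ (φ δ) (h δ)) (⟦⌜sub⌝⟧ u s δ (φ δ) (h δ)))
sub-≋ ⊥ᶠ        s h = pointwise λ _ _ _ → mk⇔ id id
sub-≋ (A₁ ∧ A₂) s h = ∧-≋ (sub-≋ A₁ s h) (sub-≋ A₂ s h)
sub-≋ (A₁ ⊃ A₂) s h = ⊃-≋ (sub-≋ A₁ s h) (sub-≋ A₂ s h)
sub-≋ (all {σ} k A) s h =
  all-≋ (⊃-≋ {P = reindex proj₁ (𝐈 k)} (pointwise λ _ _ _ → mk⇔ id id) (sub-≋ A (lift s) (lift-denotes σ s h)))
sub-≋ (ex {σ} k A) s h =
  ex-≋ (∧-≋ {P = reindex proj₁ (𝐈 k)} (pointwise λ _ _ _ → mk⇔ id id) (sub-≋ A (lift s) (lift-denotes σ s h)))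

-- Constants

weakenˡ : {P : Pred X U} {Q : Pred X V} {K : Pred X W} → P ⊢ K → P ∧ₚ Q ⊢ K
weakenˡ {P = P} {Q = Q} = ⊢-trans (∧-elimˡ {P = P} {Q = Q})

𝐈-intro : {C : Pred X U} (h : HAType ρ) (k : HAType σ) (t : X → El (ρ ⇒ σ)) →
          reindex proj₂ C ∧ₚ reindex proj₁ (𝐈 h) ⊢ reindex (λ { (y , x) → t x ⟨$⟩ y }) (𝐈 k) →
          C ⊢ reindex t (𝐈 (h ⇒ k))
𝐈-intro h k t p = ∀-intro (⊃-intro {Q = reindex proj₁ (𝐈 h)} p)

𝐈-elim : {C : Pred X U} (h : HAType ρ) (k : HAType σ) (t : X → El (ρ ⇒ σ)) (u : X → El ρ) →
         C ⊢ reindex t (𝐈 (h ⇒ k)) → C ⊢ reindex u (𝐈 h) →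
         C ⊢ reindex (λ x → t x ⟨$⟩ u x) (𝐈 k)
𝐈-elim h k t u p q =
  ⊃-elim {Q = reindex u (𝐈 h)} {K = reindex (λ x → t x ⟨$⟩ u x) (𝐈 k)}
    (∀-elim {Q = reindex proj₁ (𝐈 h) ⊃ₚ reindex (λ { (y , x) → t x ⟨$⟩ y }) (𝐈 k)} u p) q

wits : All HAType σs → WitnessTypes
wits []       = noneᵂ
wits (h ∷ hs) = witᶜᵇ h ∧ᵂ wits hs

𝐈* : (hs : All HAType σs) → Pred (Env σs) (wits hs)
𝐈* []       = ⊤ₚ
𝐈* (h ∷ hs) = reindex proj₁ (𝐈 h) ∧ₚ reindex proj₂ (𝐈* hs)

𝐈*-mono : (hs : All HAType σs) → Mono (𝐈* hs)
𝐈*-mono []       _ _ _ _ = tt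
𝐈*-mono (h ∷ hs) = ∧ₚ-mono {P = reindex proj₁ (𝐈 h)} {Q = reindex proj₂ (𝐈* hs)}
  (𝐈-mono h ∘ proj₁) (𝐈*-mono hs ∘ proj₂)

⇒*-type : All HAType σs → HAType τ → HAType (σs ⇒* τ)
⇒*-type []       k = k
⇒*-type (h ∷ hs) k = h ⇒ ⇒*-type hs k

𝐈-intro* : {C : Pred X U} (hs : All HAType σs) (k : HAType τ) (t : X → El (σs ⇒* τ)) →
           reindex proj₂ C ∧ₚ reindex proj₁ (𝐈* hs) ⊢ reindex (λ { (ys , x) → apply σs (t x) ys }) (𝐈 k) →
           C ⊢ reindex t (𝐈 (⇒*-type hs k))
𝐈-intro* {C = C} [] k t p =
  ⊢-trans (∧-intro {Q = C} {K = ⊤ₚ} ⊢-refl (⊢-top C)) (⊢-reindex (tt ,_) p)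
  where
  ⊢-top : (C : Pred X U) → C ⊢ ⊤ₚ
  ⊢-top {U = U} C = entails [] (defaults (neg U ✶*)) λ _ _ _ _ → tt
𝐈-intro* {X} {C = C} (_∷_ {ρ} {σs} h hs) k t p =
  𝐈-intro h (⇒*-type hs k) t (𝐈-intro* hs k (λ { (y , x) → t x ⟨$⟩ y })
    -- Successive abstraction nests the premises to the left, whereas `𝐈*` of a longer tuple groups
    -- the new premise with the rest of the tuple.
    (⊢-trans
      (∧-intro {Q = reindex (proj₂ ∘ proj₂) C} {K = reindex (proj₁ ∘ proj₂) (𝐈 h) ∧ₚ reindex proj₁ (𝐈* hs)}
        (weakenˡ {P = C₂ ∧ₚ Ih} {Q = Ihs} (∧-elimˡ {P = C₂} {Q = Ih}))
        (∧-intro {Q = Ih} {K = Ihs}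
          (weakenˡ {P = C₂ ∧ₚ Ih} {Q = Ihs} (∧-elimʳ {P = C₂} {Q = Ih}))
          (∧-elimʳ {P = C₂ ∧ₚ Ih} {Q = Ihs})))
      (⊢-reindex (λ { (ys , y , x) → (y , ys) , x }) p)))
  where
  C₂  = reindex (proj₂ ∘ proj₂) C
  Ih  = reindex {Y = Env σs × El ρ × X} (proj₁ ∘ proj₂) (𝐈 h)
  Ihs = reindex {Y = Env σs × El ρ × X} proj₁ (𝐈* hs)

𝐈-elim* : {C : Pred X U} (hs : All HAType σs) (k : HAType τ) (t : X → El (σs ⇒* τ)) (u : X → Env σs) →
          C ⊢ reindex t (𝐈 (⇒*-type hs k)) → C ⊢ reindex u (𝐈* hs) →
          C ⊢ reindex (λ x → apply σs (t x) (u x)) (𝐈 k)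
𝐈-elim* []       k t u p q = p
𝐈-elim* (h ∷ hs) k t u p q =
  𝐈-elim* hs k (λ x → t x ⟨$⟩ proj₁ (u x)) (proj₂ ∘ u)
    (𝐈-elim h (⇒*-type hs k) t (proj₁ ∘ u) p (⊢-trans q (∧-elimˡ {P = I₁} {Q = I₂*})))
    (⊢-trans q (∧-elimʳ {P = I₁} {Q = I₂*}))
  where
  I₁  = reindex (proj₁ ∘ u) (𝐈 h)
  I₂* = reindex (proj₂ ∘ u) (𝐈* hs)

𝐈*-lookup : {C : Pred X U} (hs : All HAType σs) (i : τ ∈ˡ σs) (u : X → Env σs) →
            C ⊢ reindex u (𝐈* hs) → C ⊢ reindex (lookup i ∘ u) (𝐈 (All.lookup hs i))
𝐈*-lookup (h ∷ hs) (here refl) u p =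
  ⊢-trans p (∧-elimˡ {P = reindex (proj₁ ∘ u) (𝐈 h)} {Q = reindex (proj₂ ∘ u) (𝐈* hs)})
𝐈*-lookup (h ∷ hs) (there i)   u p = 𝐈*-lookup hs i (proj₂ ∘ u)
  (⊢-trans p (∧-elimʳ {P = reindex (proj₁ ∘ u) (𝐈 h)} {Q = reindex (proj₂ ∘ u) (𝐈* hs)}))

step-types : All HAType σs → All HAType τs → All HAType (map (λ τ → N ⇒ σs ⇒* τ) τs)
step-types hs []       = []
step-types hs (k ∷ ks) = (N ⇒ ⇒*-type hs k) ∷ step-types hs ks

-- The components `ks` still to be treated are separated from `hs`: the recursion consumes `ks`,
-- while every step function takes the full tuple of previous values.
𝐈*-stepAll : {C : Pred X U} (hs : All HAType σs) (ks : All HAType τs)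
             (fs : X → Env (map (λ τ → N ⇒ σs ⇒* τ) τs)) (n : X → ℕ) (xs : X → Env σs) →
             C ⊢ reindex fs (𝐈* (step-types hs ks)) → C ⊢ reindex n boundedₚ →
             C ⊢ reindex xs (𝐈* hs) →
             C ⊢ reindex (λ x → stepAll σs τs (fs x) (n x) (xs x)) (𝐈* ks)
𝐈*-stepAll hs [] fs n xs p q r = ⊢-trans r (entails [] (defaults _) λ _ _ _ _ → tt)
𝐈*-stepAll {σs = σs} {τs = τ ∷ τs} hs (k ∷ ks) fs n xs p q r =
  ∧-intro {Q = reindex (λ x → apply σs (proj₁ (fs x) ⟨$⟩ n x) (xs x)) (𝐈 k)}
          {K = reindex (λ x → stepAll σs τs (proj₂ (fs x)) (n x) (xs x)) (𝐈* ks)}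
    (𝐈-elim* hs k (λ x → proj₁ (fs x) ⟨$⟩ n x) xs
      (𝐈-elim N (⇒*-type hs k) (proj₁ ∘ fs) n (⊢-trans p (∧-elimˡ {P = I₁} {Q = I₂*})) q) r)
    (𝐈*-stepAll hs ks (proj₂ ∘ fs) n xs (⊢-trans p (∧-elimʳ {P = I₁} {Q = I₂*})) q r)
  where
  I₁  = reindex (proj₁ ∘ fs) (𝐈 (N ⇒ ⇒*-type hs k))
  I₂* = reindex (proj₂ ∘ fs) (𝐈* (step-types hs ks))

𝐈-≡ : (h : HAType σ) {t u : X → El σ} → (∀ x → t x ≡ u x) → reindex t (𝐈 h) ⊢ reindex u (𝐈 h)
𝐈-≡ h eq = ⊢-pointwise λ x a b → subst (λ y → holds (𝐈 h) y a b) (eq x)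

constant-type : Con HAType σ → HAType σ
constant-type (Π h k)   = h ⇒ k ⇒ h
constant-type (Σ h k l) = (h ⇒ k ⇒ l) ⇒ (h ⇒ k) ⇒ h ⇒ l
constant-type O         = N
constant-type S         = N ⇒ N
constant-type (R hs i)  = N ⇒ ⇒*-type hs (⇒*-type (step-types hs hs) (All.lookup hs i))
constant-type O₂        = B
constant-type I₂        = B
constant-type (Cond h)  = B ⇒ h ⇒ h ⇒ h

-- The condition on constants quantifies over every proof that σ is a type of HA^ω, while
-- `constant-𝐈` yields it for the proof computed from the constant.
HAType-irrelevant : (h k : HAType σ) → h ≡ k
HAType-irrelevant N       N         = refl
HAType-irrelevant B       B         = refl
HAType-irrelevant (h ⇒ k) (h′ ⇒ k′) = cong₂ _⇒_ (HAType-irrelevant h h′) (HAType-irrelevant k k′)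

-- This covers implications between equations too, since `noneᵂ ⊃ᵂ noneᵂ` computes to `noneᵂ`.
axiom-pointwise : {Q : Pred X noneᵂ} → (∀ x → holds Q x tt tt) → ⊤ₚ ⊢ Q
axiom-pointwise h = ⊢-pointwise λ x _ _ _ → h x

Π-𝐈 : (h : HAType σ) (k : HAType τ) →
      ⊤ₚ {X = X} ⊢ reindex (λ _ → ⟦ Π {Any-type} {σ} {τ} tt tt ⟧ᶜ) (𝐈 (h ⇒ k ⇒ h))
Π-𝐈 {σ} {τ} {X} h k =
  𝐈-intro h (k ⇒ h) (λ _ → c) (𝐈-intro k h (λ (x , _) → c ⟨$⟩ x)
    (weakenˡ {P = ⊤ₚ ∧ₚ Ix} {Q = Iy} {K = Ix} (∧-elimʳ {P = ⊤ₚ} {Q = Ix})))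
  where
  c : El (σ ⇒ τ ⇒ σ)
  c = ⟦ Π {Any-type} {σ} {τ} tt tt ⟧ᶜ
  Ix = reindex {Y = El τ × El σ × X} (proj₁ ∘ proj₂) (𝐈 h)
  Iy = reindex {Y = El τ × El σ × X} proj₁ (𝐈 k)

Σ-𝐈 : (h : HAType ρ) (k : HAType σ) (l : HAType τ) →
      ⊤ₚ {X = X} ⊢ reindex (λ _ → ⟦ Σ {Any-type} {ρ} {σ} {τ} tt tt tt ⟧ᶜ)
        (𝐈 ((h ⇒ k ⇒ l) ⇒ (h ⇒ k) ⇒ h ⇒ l))
Σ-𝐈 {ρ} {σ} {τ} {X} h k l =
  𝐈-intro (h ⇒ k ⇒ l) ((h ⇒ k) ⇒ h ⇒ l) (λ _ → c) (𝐈-intro (h ⇒ k) (h ⇒ l) (λ (x , _) → c ⟨$⟩ x)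
    (𝐈-intro h l (λ (y , x , _) → c ⟨$⟩ x ⟨$⟩ y)
    (𝐈-elim k l (λ (z , y , x , _) → x ⟨$⟩ z) (λ (z , y , x , _) → y ⟨$⟩ z)
      (𝐈-elim h (k ⇒ l) (λ (z , y , x , _) → x) proj₁
        (weakenˡ {P = (⊤ₚ ∧ₚ Ix) ∧ₚ Iy} {Q = Iz} {K = Ix}
          (weakenˡ {P = ⊤ₚ ∧ₚ Ix} {Q = Iy} {K = Ix} (∧-elimʳ {P = ⊤ₚ} {Q = Ix})))
        z⊢)
      (𝐈-elim h k (λ (z , y , x , _) → y) proj₁
        (weakenˡ {P = (⊤ₚ ∧ₚ Ix) ∧ₚ Iy} {Q = Iz} {K = Iy} (∧-elimʳ {P = ⊤ₚ ∧ₚ Ix} {Q = Iy}))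
        z⊢))))
  where
  c : El ((ρ ⇒ σ ⇒ τ) ⇒ (ρ ⇒ σ) ⇒ ρ ⇒ τ)
  c = ⟦ Σ {Any-type} {ρ} {σ} {τ} tt tt tt ⟧ᶜ
  Z  = El ρ × El (ρ ⇒ σ) × El (ρ ⇒ σ ⇒ τ) × X
  Ix = reindex {Y = Z} (λ (z , y , x , _) → x) (𝐈 (h ⇒ k ⇒ l))
  Iy = reindex {Y = Z} (λ (z , y , x , _) → y) (𝐈 (h ⇒ k))
  Iz = reindex {Y = Z} proj₁ (𝐈 h)
  z⊢ : ((⊤ₚ ∧ₚ Ix) ∧ₚ Iy) ∧ₚ Iz ⊢ Iz
  z⊢ = ∧-elimʳ {P = (⊤ₚ ∧ₚ Ix) ∧ₚ Iy} {Q = Iz}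

O-bounded : {C : Pred X U} → C ⊢ reindex (λ _ → zero) boundedₚ
O-bounded = entails (con (base O) ∷ []) (defaults _) λ _ _ _ _ → z≤n

S-bounded : (n : X → ℕ) → reindex n boundedₚ ⊢ reindex (suc ∘ n) boundedₚ
S-bounded n = entails (con (base S) · v₀ ∷ []) [] λ x a d p → s≤s (p tt tt)

Cond-𝐈 : (h : HAType σ) →
         ⊤ₚ {X = X} ⊢ reindex (λ _ → ⟦ Cond {Any-type} {σ} tt ⟧ᶜ) (𝐈 (B ⇒ h ⇒ h ⇒ h))
Cond-𝐈 {σ} {X} h =
  𝐈-intro B (h ⇒ h ⇒ h) (λ _ → c) (𝐈-intro h (h ⇒ h) (λ (i , _) → c ⟨$⟩ i)
    (𝐈-intro h h (λ (x , i , _) → c ⟨$⟩ i ⟨$⟩ x)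
    (⊢-trans
      -- Both branches are merged before the Boolean is inspected; the case distinction then happens
      -- in the soundness proof alone.
      (meet-intro {Q = Ix} {K = Iy} (𝐈-mono h ∘ _) (𝐈-mono h ∘ _)
        (weakenˡ {P = (⊤ₚ ∧ₚ ⊤ₚ) ∧ₚ Ix} {Q = Iy} {K = Ix} (∧-elimʳ {P = ⊤ₚ ∧ₚ ⊤ₚ} {Q = Ix}))
        (∧-elimʳ {P = (⊤ₚ ∧ₚ ⊤ₚ) ∧ₚ Ix} {Q = Iy}))
      (⊢-pointwise λ { (y , x , false , _) a b (p , q) → p
                     ; (y , x , true  , _) a b (p , q) → q }))))
  where
  c : El (B ⇒ σ ⇒ σ ⇒ σ)
  c = ⟦ Cond {Any-type} {σ} tt ⟧ᶜ
  Ix = reindex {Y = El σ × El σ × Bool × X} (proj₁ ∘ proj₂) (𝐈 h)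
  Iy = reindex {Y = El σ × El σ × Bool × X} proj₁ (𝐈 h)

-- The step functions receive the stage number as an argument, so 𝓘 must be known of it. This is why
-- `induct` offers the bound on n as a premise of its step.
recurse-𝐈 : (hs : All HAType σs) →
            (reindex {Y = ℕ × Env σs × Env (steps σs)} (proj₁ ∘ proj₂) (𝐈* hs)
              ∧ₚ reindex (proj₂ ∘ proj₂) (𝐈* (step-types hs hs)))
            ∧ₚ reindex proj₁ boundedₚ
            ⊢ reindex (λ (n , ws , fs) → recurse σs n ws fs) (𝐈* hs)
recurse-𝐈 {σs} hs = induct {C = Iw ∧ₚ If} {D = D} (𝐈*-mono hs ∘ _) (∧-elimˡ {P = Iw} {Q = If})
  (𝐈*-stepAll hs hs (proj₂ ∘ proj₂) proj₁ (λ (n , ws , fs) → recurse σs n ws fs)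
    (weakenˡ {P = (Iw₂ ∧ₚ If₂) ∧ₚ In} {Q = D} {K = If₂}
      (weakenˡ {P = Iw₂ ∧ₚ If₂} {Q = In} {K = If₂} (∧-elimʳ {P = Iw₂} {Q = If₂})))
    (weakenˡ {P = (Iw₂ ∧ₚ If₂) ∧ₚ In} {Q = D} {K = In} (∧-elimʳ {P = Iw₂ ∧ₚ If₂} {Q = In}))
    (∧-elimʳ {P = (Iw₂ ∧ₚ If₂) ∧ₚ In} {Q = D}))
  where
  Iw  = reindex {Y = Env σs × Env (steps σs)} proj₁ (𝐈* hs)
  If  = reindex {Y = Env σs × Env (steps σs)} proj₂ (𝐈* (step-types hs hs))
  Iw₂ = reindex {Y = ℕ × _} proj₂ Iw
  If₂ = reindex {Y = ℕ × _} proj₂ If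
  In  = reindex {Y = ℕ × Env σs × Env (steps σs)} proj₁ boundedₚ
  D   = reindex {Y = ℕ × Env σs × Env (steps σs)} (λ (n , ws , fs) → recurse σs n ws fs) (𝐈* hs)

R-𝐈 : (hs : All HAType σs) (i : τ ∈ˡ σs) (ps : All Any-type σs) →
      ⊤ₚ {X = X} ⊢ reindex (λ _ → ⟦ R ps i ⟧ᶜ) (𝐈 (constant-type (R hs i)))
R-𝐈 {σs} {τ} {X} hs i ps =
  𝐈-intro N (⇒*-type hs (⇒*-type hss (All.lookup hs i))) (λ _ → ⟦ R ps i ⟧ᶜ)
    (𝐈-intro* hs (⇒*-type hss (All.lookup hs i)) (λ (n , _) → ⟦ R ps i ⟧ᶜ ⟨$⟩ n)
      (𝐈-intro* hss (All.lookup hs i) (λ (ws , n , _) → apply σs (⟦ R ps i ⟧ᶜ ⟨$⟩ n) ws)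
        (⊢-trans
          (𝐈*-lookup hs i (λ (fs , ws , n , _) → recurse σs n ws fs)
            (⊢-trans rearrange (⊢-reindex (λ (fs , ws , n , _) → n , ws , fs) (recurse-𝐈 hs))))
          (𝐈-≡ (All.lookup hs i) λ (fs , ws , n , _) → sym (apply-R σs ps i n ws fs)))))
  where
  hss = step-types hs hs
  Z   = Env (steps σs) × Env σs × ℕ × X
  In  = reindex {Y = Z} (λ (fs , ws , n , _) → n) boundedₚ
  Iw  = reindex {Y = Z} (λ (fs , ws , n , _) → ws) (𝐈* hs)
  If  = reindex {Y = Z} proj₁ (𝐈* hss)
  rearrange : ((⊤ₚ ∧ₚ In) ∧ₚ Iw) ∧ₚ If ⊢ (Iw ∧ₚ If) ∧ₚ In
  rearrange = ∧-intro {Q = Iw ∧ₚ If} {K = In}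
    (∧-intro {Q = Iw} {K = If}
      (weakenˡ {P = (⊤ₚ ∧ₚ In) ∧ₚ Iw} {Q = If} {K = Iw} (∧-elimʳ {P = ⊤ₚ ∧ₚ In} {Q = Iw}))
      (∧-elimʳ {P = (⊤ₚ ∧ₚ In) ∧ₚ Iw} {Q = If}))
    (weakenˡ {P = (⊤ₚ ∧ₚ In) ∧ₚ Iw} {Q = If} {K = In}
      (weakenˡ {P = ⊤ₚ ∧ₚ In} {Q = Iw} {K = In} (∧-elimʳ {P = ⊤ₚ} {Q = In})))

constant-𝐈 : (c : Con HAType σ) → ⊤ₚ {X = X} ⊢ reindex (λ _ → ⟦ forgetᶜ c ⟧ᶜ) (𝐈 (constant-type c))
constant-𝐈 (Π h k)   = Π-𝐈 h k
constant-𝐈 (Σ h k l) = Σ-𝐈 h k l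
constant-𝐈 O         = O-bounded
constant-𝐈 S         = 𝐈-intro N N (λ _ → ⟦ S {Any-type} ⟧ᶜ)
  (⊢-trans (∧-elimʳ {P = ⊤ₚ} {Q = reindex proj₁ boundedₚ}) (S-bounded proj₁))
constant-𝐈 (R hs i)  = R-𝐈 hs i (All.map (λ _ → tt) hs)
constant-𝐈 O₂        = ⊢-refl
constant-𝐈 I₂        = ⊢-refl
constant-𝐈 (Cond h)  = Cond-𝐈 h

-- Axioms

closeᴵ-intro : (hs : All HAType Γ) (A : Formula 𝓛ᴵ Γ) → ⊤ₚ ⊢ sem A → ⊤ₚ ⊢ sem (closeᴵ hs A)
closeᴵ-intro []       A p = p
closeᴵ-intro (h ∷ hs) A p = closeᴵ-intro hs (all h (𝓘ᶠ h v₀ ⊃ A))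
  (∀-intro (⊃-intro {Q = Ix} {K = sem A} (weakenˡ {P = ⊤ₚ} {Q = Ix} {K = sem A} p)))
  where Ix = reindex proj₁ (𝐈 h)

⊤-⊃-intro : {P : Pred X V} {Q : Pred X W} → P ⊢ Q → ⊤ₚ ⊢ P ⊃ₚ Q
⊤-⊃-intro {P = P} {Q} p = ⊃-intro {P = ⊤ₚ} {Q = P} {K = Q} (⊢-trans (∧-elimʳ {P = ⊤ₚ} {Q = P}) p)

module _ {Γ} (D : Formula HAω (σ ∷ Γ)) where

  private
    P : Pred (Env (σ ∷ Γ)) _
    P = sem (D ᴵ)

  ≐-subst-valid : ⊤ₚ ⊢ sem ((v₁ ≐ v₀ ∧ (D [ v₁ ∷ oldˢ (σ ∷ σ ∷ []) ]ᶠ)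
                            ⊃ (D [ v₀ ∷ oldˢ (σ ∷ σ ∷ []) ]ᶠ)) ᴵ)
  ≐-subst-valid = ⊤-⊃-intro {P = eq ∧ₚ sem ((D [ s₁ ]ᶠ) ᴵ)}
    (⊢-trans (⊢-trans
      (∧-intro {Q = eq} {K = reindex (λ (y , x , γ) → x , γ) P}
        (∧-elimˡ {P = eq} {Q = sem ((D [ s₁ ]ᶠ) ᴵ)})
        (⊢-trans (∧-elimʳ {P = eq} {Q = sem ((D [ s₁ ]ᶠ) ᴵ)})
          (≋⇒⊢ (sub-≋ D s₁ (∷-denotes v₁ (oldˢ _) (λ _ → refl) (old-denotes (σ ∷ σ ∷ []) Γ))))))
      (⊢-pointwise λ (y , x , γ) a b (x≈y , p) → sem-cong (D ᴵ) (x≈y , Setoid.refl (Envₛ Γ)) p))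
      (≋⇒⊣ (sub-≋ D s₀ (∷-denotes v₀ (oldˢ _) (λ _ → refl) (old-denotes (σ ∷ σ ∷ []) Γ)))))
    where
    s₀ s₁ : Terms (Con HAType) (σ ∷ σ ∷ Γ) (σ ∷ Γ)
    s₀ = v₀ ∷ oldˢ (σ ∷ σ ∷ [])
    s₁ = v₁ ∷ oldˢ (σ ∷ σ ∷ [])
    eq : Pred (Env (σ ∷ σ ∷ Γ)) noneᵂ
    eq = sem {Γ = σ ∷ σ ∷ Γ} (_≐_ {σ = σ} v₁ v₀)

B-cases-valid : (D : Formula HAω (B ∷ Γ)) →
                ⊤ₚ ⊢ sem (((D [ con O₂ ∷ idˢ ]ᶠ) ∧ (D [ con I₂ ∷ idˢ ]ᶠ) ⊃ all B D) ᴵ)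
B-cases-valid {Γ} D = ⊤-⊃-intro {P = P₀ ∧ₚ P₁} (∀-intro (⊃-intro {Q = ⊤ₚ} {K = P}
  (weakenˡ {P = reindex proj₂ (P₀ ∧ₚ P₁)} {Q = ⊤ₚ} {K = P}
    (⊢-trans (⊢-reindex proj₂ both)
      (⊢-pointwise λ { (false , γ) a b (p , q) → p ; (true , γ) a b (p , q) → q })))))
  where
  P  = sem (D ᴵ)
  P₀ = sem ((D [ con O₂ ∷ idˢ ]ᶠ) ᴵ)
  P₁ = sem ((D [ con I₂ ∷ idˢ ]ᶠ) ᴵ)
  both : P₀ ∧ₚ P₁ ⊢ meetₚ (reindex (false ,_) P) (reindex (true ,_) P)
  both = meet-intro (sem-mono (D ᴵ) ∘ (false ,_)) (sem-mono (D ᴵ) ∘ (true ,_))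
    (⊢-trans (∧-elimˡ {P = P₀} {Q = P₁})
      (≋⇒⊢ (sub-≋ D _ (∷-denotes (con O₂) idˢ (λ _ → refl) (id-denotes Γ)))))
    (⊢-trans (∧-elimʳ {P = P₀} {Q = P₁})
      (≋⇒⊢ (sub-≋ D _ (∷-denotes (con I₂) idˢ (λ _ → refl) (id-denotes Γ)))))

induction-valid : (D : Formula HAω (N ∷ Γ)) →
                  ⊤ₚ ⊢ sem (((D [ con O ∷ idˢ ]ᶠ) ∧ all N (D ⊃ (D [ con S · v₀ ∷ oldˢ (N ∷ []) ]ᶠ))
                             ⊃ all N D) ᴵ)
induction-valid {Γ} D = ⊤-⊃-intro {P = P₀ ∧ₚ step} (∀-intro (⊃-intro {Q = In} {K = P}
  (induct {C = P₀ ∧ₚ step} {D = P} (sem-mono (D ᴵ))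
    (⊢-trans (∧-elimˡ {P = P₀} {Q = step})
      (≋⇒⊢ (sub-≋ D _ (∷-denotes (con O) idˢ (λ _ → refl) (id-denotes Γ)))))
    (⊢-trans
      (⊃-elim {Q = P} {K = P₊}
        (weakenˡ {P = K₀ ∧ₚ In} {Q = P} {K = P ⊃ₚ P₊}
          (⊃-elim {Q = In} {K = P ⊃ₚ P₊}
            -- The relativized step premise is part of the context of the induction; it is
            -- instantiated here at the current number.
            (weakenˡ {P = K₀} {Q = In} {K = In ⊃ₚ P ⊃ₚ P₊} (⊢-trans
              (∧-elimʳ {P = reindex proj₂ P₀} {Q = reindex proj₂ step})
              (∀-elim {P = reindex proj₂ step} {Q = reindex (λ (n , _ , γ) → n , γ) (In ⊃ₚ P ⊃ₚ P₊)}
                proj₁ ⊢-refl)))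
            (∧-elimʳ {P = K₀} {Q = In})))
        (∧-elimʳ {P = K₀ ∧ₚ In} {Q = P}))
      (≋⇒⊢ (sub-≋ D _ (∷-denotes (con S · v₀) (oldˢ _) (λ _ → refl) (old-denotes (N ∷ []) Γ))))))))
  where
  P    = sem (D ᴵ)
  P₀   = sem ((D [ con O ∷ idˢ ]ᶠ) ᴵ)
  P₊   = sem ((D [ con S · v₀ ∷ oldˢ (N ∷ []) ]ᶠ) ᴵ)
  In   = reindex {Y = Env (N ∷ Γ)} proj₁ boundedₚ
  step = allₚ (In ⊃ₚ P ⊃ₚ P₊)
  K₀   = reindex {Y = Env (N ∷ Γ)} proj₂ (P₀ ∧ₚ step)

-- Equations for the recursors

⟦⌜·*⌝⟧ : (t : Term (Con HAType) Γ (σs ⇒* τ)) (us : Terms (Con HAType) Γ σs) (γ : Env Γ) {xs : Env σs} →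
         (∀ {σ} (i : σ ∈ˡ σs) → ⟦ ⌜ All.lookup us i ⌝ ⟧ᵗ γ ≡ lookup i xs) →
         ⟦ ⌜ t ·* us ⌝ ⟧ᵗ γ ≡ apply σs (⟦ ⌜ t ⌝ ⟧ᵗ γ) xs
⟦⌜·*⌝⟧ t []       γ         h = refl
⟦⌜·*⌝⟧ {σs = _ ∷ σs} t (u ∷ us) γ {x , xs} h =
  trans (⟦⌜·*⌝⟧ (t · u) us γ (h ∘ there))
    (cong (λ x → apply σs (⟦ ⌜ t ⌝ ⟧ᵗ γ ⟨$⟩ x) xs) (h (here refl)))

⟦⌜recᵗ⌝⟧ : (hs : All HAType σs) (i : τ ∈ˡ σs) (n : Term (Con HAType) Γ N)
           (w : Terms (Con HAType) Γ σs) (f : Terms (Con HAType) Γ (steps σs)) {ws : Env Γ → Env σs}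
           {fs : Env Γ → Env (steps σs)} → Denotes w ws → Denotes f fs → ∀ γ →
           ⟦ ⌜ recᵗ hs i n w f ⌝ ⟧ᵗ γ ≡ lookup i (recurse σs (⟦ ⌜ n ⌝ ⟧ᵗ γ) (ws γ) (fs γ))
⟦⌜recᵗ⌝⟧ {σs} hs i n w f {ws} {fs} hw hf γ =
  trans (⟦⌜·*⌝⟧ (_ ·* w) f γ (hf γ))
    (trans (cong (λ t → apply (steps σs) t (fs γ)) (⟦⌜·*⌝⟧ (con (R hs i) · n) w γ (hw γ)))
      (apply-R σs (All.map (λ _ → tt) hs) i (⟦ ⌜ n ⌝ ⟧ᵗ γ) (ws γ) (fs γ)))

⟦⌜stepᵗ⌝⟧ : ∀ σs τs (i : τ ∈ˡ τs) (f : Terms (Con HAType) Γ (map (λ τ → N ⇒ σs ⇒* τ) τs))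
            (n : Term (Con HAType) Γ N) (u : Terms (Con HAType) Γ σs) (γ : Env Γ) {fs xs} →
            (∀ {σ} (i : σ ∈ˡ _) → ⟦ ⌜ All.lookup f i ⌝ ⟧ᵗ γ ≡ lookup i fs) →
            (∀ {σ} (i : σ ∈ˡ σs) → ⟦ ⌜ All.lookup u i ⌝ ⟧ᵗ γ ≡ lookup i xs) →
            ⟦ ⌜ (All.lookup (map⁻ f) i · n) ·* u ⌝ ⟧ᵗ γ ≡ lookup i (stepAll σs τs fs (⟦ ⌜ n ⌝ ⟧ᵗ γ) xs)
⟦⌜stepᵗ⌝⟧ σs (_ ∷ τs) (here refl) (g ∷ f) n u γ {xs = xs} hf hu =
  trans (⟦⌜·*⌝⟧ (g · n) u γ hu)
    (cong (λ g → apply σs (g ⟨$⟩ ⟦ ⌜ n ⌝ ⟧ᵗ γ) xs) (hf (here refl)))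
⟦⌜stepᵗ⌝⟧ σs (_ ∷ τs) (there i) (g ∷ f) n u γ hf hu =
  ⟦⌜stepᵗ⌝⟧ σs τs i f n u γ (hf ∘ there) hu

≡⇒≈ : ∀ σ {x y : El σ} → x ≡ y → _≈_ {σ} x y
≡⇒≈ σ refl = Setoid.refl ⟦ σ ⟧

axiom-valid : {A : Formula HAω Γ} → Axiom A → ⊤ₚ ⊢ sem (A ᴵ)
axiom-valid (≐-refl {σ})       = axiom-pointwise λ _ → Setoid.refl ⟦ σ ⟧
axiom-valid (≐-subst D)        = ≐-subst-valid D
axiom-valid (Π-axiom {σ} _ _)  = axiom-pointwise λ _ → Setoid.refl ⟦ σ ⟧
axiom-valid (Σ-axiom {τ = τ} _ _ _) = axiom-pointwise λ _ → Setoid.refl ⟦ τ ⟧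
-- A premise is given as a family over its challenges; without challenge types the only one is the
-- empty tuple, hence `p tt tt`.
axiom-valid S-injective        = axiom-pointwise λ _ p → ℕₚ.suc-injective (p tt tt)
axiom-valid S-nonzero          = axiom-pointwise λ _ p → case p tt tt of λ ()
axiom-valid (R-zero {σs} {τ} hs i) = axiom-pointwise λ γ → ≡⇒≈ τ
  (trans (⟦⌜recᵗ⌝⟧ hs i (con O) (newˢ σs) (oldˢ σs)
           (new-denotes σs (steps σs)) (old-denotes σs (steps σs)) γ)
    (sym (new-denotes σs (steps σs) γ i)))
axiom-valid (R-suc {σs} {τ} hs i) = axiom-pointwise λ γ → ≡⇒≈ τ
  (trans (⟦⌜recᵗ⌝⟧ hs i (con S · v₀) w f w-denotes f-denotes γ)
    (sym (⟦⌜stepᵗ⌝⟧ σs σs i f v₀ (All.tabulate (λ j → recᵗ hs j v₀ w f)) γ (f-denotes γ)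
      (tabulate-denotes (λ j → recᵗ hs j v₀ w f) (λ γ j → ⟦⌜recᵗ⌝⟧ hs j v₀ w f w-denotes f-denotes γ) γ))))
  where
  w = wk* (N ∷ []) (newˢ {C = Con HAType} {Γ = steps σs} σs)
  f = wk* (N ∷ []) (oldˢ {C = Con HAType} {Γ = steps σs} σs)
  w-denotes = wk-denotes (N ∷ []) (newˢ σs) (new-denotes σs (steps σs))
  f-denotes = wk-denotes (N ∷ []) (oldˢ σs) (old-denotes σs (steps σs))
axiom-valid O₂≢I₂              = axiom-pointwise λ _ p → case p tt tt of λ ()
axiom-valid (B-cases D)        = B-cases-valid D
axiom-valid (Cond-0 {σ} _)     = axiom-pointwise λ _ → Setoid.refl ⟦ σ ⟧
axiom-valid (Cond-1 {σ} _)     = axiom-pointwise λ _ → Setoid.refl ⟦ σ ⟧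
axiom-valid (induction D)      = induction-valid D

theorem8p21 : SoundTypeInformative 𝓘ᶜᵇ
theorem8p21 = record
  { constants   = λ h c → interpret (𝓘ᶠ h (con c))
      (subst (λ h → ⊤ₚ ⊢ reindex (λ _ → ⟦ forgetᶜ c ⟧ᶜ) (𝐈 h))
        (HAType-irrelevant (constant-type c) h) (constant-𝐈 c))
  ; application = λ {σ} {τ} hσ hτ →
      let Ix = reindex {Y = Env ((σ ⇒ τ) ∷ σ ∷ [])} (λ (f , x , _) → x) (𝐈 hσ)
          If = reindex {Y = Env ((σ ⇒ τ) ∷ σ ∷ [])} proj₁ (𝐈 (hσ ⇒ hτ))
      in interpret (all hσ (all (hσ ⇒ hτ) (𝓘ᶠ hσ v₁ ∧ 𝓘ᶠ (hσ ⇒ hτ) v₀ ⊃ 𝓘ᶠ hτ (v₀ · v₁))))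
         (∀-intro (∀-intro (⊤-⊃-intro {P = Ix ∧ₚ If}
           (𝐈-elim hσ hτ proj₁ (λ (f , x , _) → x)
             (∧-elimʳ {P = Ix} {Q = If}) (∧-elimˡ {P = Ix} {Q = If})))))
  ; axioms      = λ hs {A} ax → interpret (closeᴵ hs (A ᴵ)) (closeᴵ-intro hs (A ᴵ) (axiom-valid ax))
  }
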